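{- There exist an absolute constant $c>0$ and, for every positive integer $s$, a constant $C_s>0$ such that the following holds for all positive integers $d,t$ and all integers $n\ge 3$. Let $\mathcal{H}$ be a set of $s$ half-spaces in $\mathbb{R}^d$, let $Q$ be a set of $n$ polytopes, each of which is an intersection of translates of elements of $\mathcal{H}$, and let $X$ be a set of $n$ points in $\mathbb{R}^d$. If the incidence graph $G$ of $X$ and $Q$ is $K_{t,t}$-free, then $G$ has at most $C_s\,t\,n(\log n)^{cd}$ edges.
   Context: The incidence graph of a set of points $X$ and a set $Q$ of subsets of $\mathbb{R}^d$ is the bipartite graph with vertex classes $X$ and $Q$ in which $x\in X$ and $q\in Q$ are adjacent if and only if $x\in q$. Polytopes here are intersections of finitely many half-spaces (not necessarily bounded). A graph is $K_{t,t}$-free if it has no subgraph isomorphic to the complete bipartite graph with both classes of size $t$. -}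

module Defs where

open import Data.Empty using (⊥)
open import Data.Fin.Base using (Fin)
open import Data.Integer.Base as ℤ using (+_)
import Data.Integer.Properties as ℤ
import Data.Integer.Tactic.RingSolver as ℤ using (solve-∀)
open import Data.List.Base using (List; length)
open import Data.List.Relation.Unary.All using (All)
open import Data.List.Relation.Unary.AllPairs using (AllPairs)
open import Data.Nat.Base as ℕ using (ℕ; zero; suc)
import Data.Nat.Properties as ℕ
open import Data.Nat.Tactic.RingSolver using (solve-∀)
open import Data.Product using (∃; ∃₂; ∃-syntax; _×_; _,_; proj₁; proj₂; uncurry)
open import Data.Rational.Base as ℚ using (ℚ; mkℚ; 0ℚ; 1ℚ; ½; ∣_∣)
import Data.Rational.Properties as ℚ
open import Data.Rational.Solver using (module +-*-Solver)
open import Data.Rational.Unnormalised.Base as ℚᵘ using (mkℚᵘ)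
import Data.Rational.Unnormalised.Properties as ℚᵘ
open import Data.Sum.Base using (_⊎_; inj₁; inj₂)
open import Data.Unit.Base using (⊤)
open import Data.Vec.Functional using (Vector; foldr; zipWith)
open import Data.Vec.Functional.Relation.Binary.Pointwise using (Pointwise)
open import Function.Definitions using (Injective)
open import Level using (0ℓ)
open import Relation.Binary.PropositionalEquality
  using (_≡_; refl; sym; trans; cong; cong₂; subst; subst₂)
open import Relation.Nullary using (¬_)
open import Relation.Unary using (Pred; _∈_; _≐_)

open +-*-Solver using (solve; _:+_; _:*_; _:-_; :-_; _:=_; con)

------------------------------------------------------------------------
-- Real numbers

IsCauchy : (ℕ → ℚ) → Set
IsCauchy f = ∀ ε → 0ℚ ℚ.< ε →
  ∃[ N ] (∀ {m n} → N ℕ.≤ m → N ℕ.≤ n → ∣ f m ℚ.- f n ∣ ℚ.< ε)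

-- Distinct elements of ℝ may denote the same number; equality is _≈_ below.
record ℝ : Set where
  constructor mkℝ
  field
    seq    : ℕ → ℚ
    cauchy : IsCauchy seq

open ℝ public

infix 4 _<_ _≤_ _≈_

_<_ : ℝ → ℝ → Set
x < y = ∃[ ε ] 0ℚ ℚ.< ε × ∃[ N ] (∀ {m} → N ℕ.≤ m → seq x m ℚ.+ ε ℚ.≤ seq y m)

_≤_ : ℝ → ℝ → Set
x ≤ y = ¬ (y < x)

_≈_ : ℝ → ℝ → Set
x ≈ y = x ≤ y × y ≤ x

module CauchyLemmas where
  identity₁ : ∀ a b c d → (a ℚ.+ b) ℚ.- (c ℚ.+ d) ≡ (a ℚ.- c) ℚ.+ (b ℚ.- d)
  identity₁ = solve 4 (λ a b c d → (a :+ b) :- (c :+ d) := (a :- c) :+ (b :- d)) refl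

  identity₂ : ∀ a b → ℚ.- (a ℚ.- b) ≡ (ℚ.- a) ℚ.- (ℚ.- b)
  identity₂ = solve 2 (λ a b → :- (a :- b) := (:- a) :- (:- b)) refl

  identity₃ : ∀ a b → a ≡ (a ℚ.- b) ℚ.+ b
  identity₃ = solve 2 (λ a b → a := (a :- b) :+ b) refl

  identity₄ : ∀ a b c d → a ℚ.* b ℚ.- c ℚ.* d ≡ a ℚ.* (b ℚ.- d) ℚ.+ d ℚ.* (a ℚ.- c)
  identity₄ = solve 4 (λ a b c d → a :* b :- c :* d := a :* (b :- d) :+ d :* (a :- c)) refl

  identity₅ : ∀ a b → (a ℚ.+ 1ℚ) ℚ.* b ≡ a ℚ.* b ℚ.+ b
  identity₅ = solve 2 (λ a b → (a :+ con 1ℚ) :* b := a :* b :+ b) refl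

  identity₆ : ∀ a b c → a ℚ.- b ≡ (a ℚ.+ c) ℚ.- (b ℚ.+ c)
  identity₆ = solve 3 (λ a b c → a :- b := (a :+ c) :- (b :+ c)) refl

  identity₇ : ∀ a b c → a ℚ.- (b ℚ.+ c) ℚ.+ c ≡ a ℚ.- b
  identity₇ = solve 3 (λ a b c → a :- (b :+ c) :+ c := a :- b) refl

  identity₈ : ∀ a b c → a ℚ.+ b ℚ.- c ≡ a ℚ.- c ℚ.+ b
  identity₈ = solve 3 (λ a b c → a :+ b :- c := a :- c :+ b) refl

  identity₉ : ∀ a b → a ℚ.+ b ℚ.- a ≡ b
  identity₉ = solve 2 (λ a b → a :+ b :- a := b) refl

  identity₁₀ : ∀ a b → ℚ.- (a ℚ.- b) ≡ b ℚ.- a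
  identity₁₀ = solve 2 (λ a b → :- (a :- b) := b :- a) refl

  0<½ε : ∀ {ε} → 0ℚ ℚ.< ε → 0ℚ ℚ.< ½ ℚ.* ε
  0<½ε {ε} 0<ε = subst (ℚ._< ½ ℚ.* ε) (ℚ.*-zeroʳ ½) (ℚ.*-monoʳ-<-pos ½ 0<ε)

  ½+½ : ∀ ε → ½ ℚ.* ε ℚ.+ ½ ℚ.* ε ≡ ε
  ½+½ = solve 1 (λ e → con ½ :* e :+ con ½ :* e := e) refl

  const-cauchy : ∀ q → IsCauchy (λ _ → q)
  const-cauchy q ε 0<ε = 0 , λ _ _ →
    subst (ℚ._< ε) (sym (cong ∣_∣ (ℚ.+-inverseʳ q))) 0<ε

  +-cauchy : ∀ {f g} → IsCauchy f → IsCauchy g → IsCauchy (λ k → f k ℚ.+ g k)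
  +-cauchy {f} {g} cf cg ε 0<ε with cf (½ ℚ.* ε) (0<½ε 0<ε) | cg (½ ℚ.* ε) (0<½ε 0<ε)
  ... | M , hM | N , hN = M ℕ.⊔ N , λ {m} {n} p q → begin-strict
      ∣ (f m ℚ.+ g m) ℚ.- (f n ℚ.+ g n) ∣
        ≡⟨ cong ∣_∣ (identity₁
             (f m) (g m) (f n) (g n)) ⟩
      ∣ (f m ℚ.- f n) ℚ.+ (g m ℚ.- g n) ∣
        ≤⟨ ℚ.∣p+q∣≤∣p∣+∣q∣ (f m ℚ.- f n) (g m ℚ.- g n) ⟩
      ∣ f m ℚ.- f n ∣ ℚ.+ ∣ g m ℚ.- g n ∣
        <⟨ ℚ.+-mono-< (hM (ℕ.m⊔n≤o⇒m≤o M N p) (ℕ.m⊔n≤o⇒m≤o M N q))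
                      (hN (ℕ.m⊔n≤o⇒n≤o M N p) (ℕ.m⊔n≤o⇒n≤o M N q)) ⟩
      ½ ℚ.* ε ℚ.+ ½ ℚ.* ε
        ≡⟨ ½+½ ε ⟩
      ε ∎
    where open ℚ.≤-Reasoning

  neg-cauchy : ∀ {f} → IsCauchy f → IsCauchy (λ k → ℚ.- f k)
  neg-cauchy {f} cf ε 0<ε with cf ε 0<ε
  ... | N , h = N , λ {m} {n} p q → subst (ℚ._< ε)
    (trans (sym (ℚ.∣-p∣≡∣p∣ (f m ℚ.- f n)))
           (cong ∣_∣ (identity₂ (f m) (f n))))
    (h p q)

  eventually-bounded : ∀ {f} → IsCauchy f →
    ∃[ N ] ∃[ B ] 0ℚ ℚ.< B × (∀ {m} → N ℕ.≤ m → ∣ f m ∣ ℚ.≤ B)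
  eventually-bounded {f} cf with cf 1ℚ (ℚ.positive⁻¹ 1ℚ)
  ... | N , h = N , 1ℚ ℚ.+ ∣ f N ∣ ,
      ℚ.+-mono-<-≤ (ℚ.positive⁻¹ 1ℚ) (ℚ.0≤∣p∣ (f N)) ,
      λ {m} p → begin
        ∣ f m ∣                        ≡⟨ cong ∣_∣ (identity₃ (f m) (f N)) ⟩
        ∣ (f m ℚ.- f N) ℚ.+ f N ∣      ≤⟨ ℚ.∣p+q∣≤∣p∣+∣q∣ (f m ℚ.- f N) (f N) ⟩
        ∣ f m ℚ.- f N ∣ ℚ.+ ∣ f N ∣    ≤⟨ ℚ.+-monoˡ-≤ ∣ f N ∣ (ℚ.<⇒≤ (h p ℕ.≤-refl)) ⟩
        1ℚ ℚ.+ ∣ f N ∣                 ∎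
    where open ℚ.≤-Reasoning

  divide : ∀ B ε → 0ℚ ℚ.< B → 0ℚ ℚ.< ε → ∃[ δ ] 0ℚ ℚ.< δ × B ℚ.* δ ≡ ε
  divide B ε 0<B 0<ε = 1/B ℚ.* ε , 0<δ , eq
    where
    instance
      B-positive : ℚ.Positive B
      B-positive = ℚ.positive 0<B
      B-nonZero : ℚ.NonZero B
      B-nonZero = ℚ.pos⇒nonZero B
    1/B : ℚ
    1/B = ℚ.1/ B
    instance
      1/B-positive : ℚ.Positive 1/B
      1/B-positive = ℚ.1/pos⇒pos B
    0<δ : 0ℚ ℚ.< 1/B ℚ.* ε
    0<δ = subst (ℚ._< 1/B ℚ.* ε) (ℚ.*-zeroʳ 1/B) (ℚ.*-monoʳ-<-pos 1/B 0<ε)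
    eq : B ℚ.* (1/B ℚ.* ε) ≡ ε
    eq = trans (sym (ℚ.*-assoc B 1/B ε))
               (trans (cong (ℚ._* ε) (ℚ.*-inverseʳ B)) (ℚ.*-identityˡ ε))

  ∣*∣-bound : ∀ p q {B δ} → ∣ p ∣ ℚ.≤ B → 0ℚ ℚ.< B → ∣ q ∣ ℚ.< δ → ∣ p ℚ.* q ∣ ℚ.< B ℚ.* δ
  ∣*∣-bound p q {B} {δ} p≤B 0<B q<δ = begin-strict
      ∣ p ℚ.* q ∣      ≡⟨ ℚ.∣p*q∣≡∣p∣*∣q∣ p q ⟩
      ∣ p ∣ ℚ.* ∣ q ∣  ≤⟨ ℚ.*-monoʳ-≤-nonNeg ∣ q ∣ {{ℚ.nonNegative (ℚ.0≤∣p∣ q)}} p≤B ⟩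
      B ℚ.* ∣ q ∣      <⟨ ℚ.*-monoʳ-<-pos B {{ℚ.positive 0<B}} q<δ ⟩
      B ℚ.* δ          ∎
    where open ℚ.≤-Reasoning

  *-cauchy : ∀ {f g} → IsCauchy f → IsCauchy g → IsCauchy (λ k → f k ℚ.* g k)
  *-cauchy {f} {g} cf cg ε 0<ε =
    combine (eventually-bounded cf) (eventually-bounded cg)
    where
    open ℚ.≤-Reasoning
    EventuallyBounded : (ℕ → ℚ) → Set
    EventuallyBounded h = ∃[ N ] ∃[ B ] 0ℚ ℚ.< B × (∀ {m} → N ℕ.≤ m → ∣ h m ∣ ℚ.≤ B)

    estimate : ∀ {A B α β} m n → 0ℚ ℚ.< A → 0ℚ ℚ.< B → ∣ f m ∣ ℚ.≤ A → ∣ g n ∣ ℚ.≤ B →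
      ∣ g m ℚ.- g n ∣ ℚ.< α → ∣ f m ℚ.- f n ∣ ℚ.< β → A ℚ.* α ≡ ½ ℚ.* ε → B ℚ.* β ≡ ½ ℚ.* ε →
      ∣ f m ℚ.* g m ℚ.- f n ℚ.* g n ∣ ℚ.< ε
    estimate {A} {B} {α} {β} m n 0<A 0<B f≤A g≤B g<α f<β Aα Bβ = begin-strict
      ∣ f m ℚ.* g m ℚ.- f n ℚ.* g n ∣
        ≡⟨ cong ∣_∣ (identity₄ (f m) (g m) (f n) (g n)) ⟩
      ∣ f m ℚ.* (g m ℚ.- g n) ℚ.+ g n ℚ.* (f m ℚ.- f n) ∣
        ≤⟨ ℚ.∣p+q∣≤∣p∣+∣q∣ (f m ℚ.* (g m ℚ.- g n)) (g n ℚ.* (f m ℚ.- f n)) ⟩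
      ∣ f m ℚ.* (g m ℚ.- g n) ∣ ℚ.+ ∣ g n ℚ.* (f m ℚ.- f n) ∣
        <⟨ ℚ.+-mono-< (∣*∣-bound (f m) (g m ℚ.- g n) f≤A 0<A g<α)
                      (∣*∣-bound (g n) (f m ℚ.- f n) g≤B 0<B f<β) ⟩
      A ℚ.* α ℚ.+ B ℚ.* β
        ≡⟨ cong₂ ℚ._+_ Aα Bβ ⟩
      ½ ℚ.* ε ℚ.+ ½ ℚ.* ε
        ≡⟨ ½+½ ε ⟩
      ε ∎

    combine : EventuallyBounded f → EventuallyBounded g →
      ∃[ N ] (∀ {m n} → N ℕ.≤ m → N ℕ.≤ n → ∣ f m ℚ.* g m ℚ.- f n ℚ.* g n ∣ ℚ.< ε)
    combine (F , A , 0<A , f≤A) (G , B , 0<B , g≤B) =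
      close (divide A (½ ℚ.* ε) 0<A (0<½ε 0<ε)) (divide B (½ ℚ.* ε) 0<B (0<½ε 0<ε))
      where
      close : (∃[ α ] 0ℚ ℚ.< α × A ℚ.* α ≡ ½ ℚ.* ε) → (∃[ β ] 0ℚ ℚ.< β × B ℚ.* β ≡ ½ ℚ.* ε) →
        ∃[ N ] (∀ {m n} → N ℕ.≤ m → N ℕ.≤ n → ∣ f m ℚ.* g m ℚ.- f n ℚ.* g n ∣ ℚ.< ε)
      close (α , 0<α , Aα) (β , 0<β , Bβ) = K , λ {m} {n} p q →
        estimate m n 0<A 0<B
          (f≤A (ℕ.m⊔n≤o⇒m≤o F G (ℕ.m⊔n≤o⇒m≤o (F ℕ.⊔ G) (M ℕ.⊔ N) p)))
          (g≤B (ℕ.m⊔n≤o⇒n≤o F G (ℕ.m⊔n≤o⇒m≤o (F ℕ.⊔ G) (M ℕ.⊔ N) q)))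
          (proj₂ (cg α 0<α) (ℕ.m⊔n≤o⇒m≤o M N (ℕ.m⊔n≤o⇒n≤o (F ℕ.⊔ G) (M ℕ.⊔ N) p))
                            (ℕ.m⊔n≤o⇒m≤o M N (ℕ.m⊔n≤o⇒n≤o (F ℕ.⊔ G) (M ℕ.⊔ N) q)))
          (proj₂ (cf β 0<β) (ℕ.m⊔n≤o⇒n≤o M N (ℕ.m⊔n≤o⇒n≤o (F ℕ.⊔ G) (M ℕ.⊔ N) p))
                            (ℕ.m⊔n≤o⇒n≤o M N (ℕ.m⊔n≤o⇒n≤o (F ℕ.⊔ G) (M ℕ.⊔ N) q)))
          Aα Bβ
        where
        M N K : ℕ
        M = proj₁ (cg α 0<α)
        N = proj₁ (cf β 0<β)
        K = (F ℕ.⊔ G) ℕ.⊔ (M ℕ.⊔ N)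

open CauchyLemmas

infixl 6 _+_ _-_
infixl 7 _*_
infixr 8 _^_

fromℚ : ℚ → ℝ
fromℚ q = mkℝ (λ _ → q) (const-cauchy q)

fromℕ : ℕ → ℝ
fromℕ n = fromℚ (+ n ℚ./ 1)

0ℝ 1ℝ : ℝ
0ℝ = fromℚ 0ℚ
1ℝ = fromℚ 1ℚ

_+_ _*_ : ℝ → ℝ → ℝ
x + y = mkℝ (λ k → seq x k ℚ.+ seq y k) (+-cauchy {seq x} {seq y} (cauchy x) (cauchy y))
x * y = mkℝ (λ k → seq x k ℚ.* seq y k) (*-cauchy {seq x} {seq y} (cauchy x) (cauchy y))

neg : ℝ → ℝ
neg x = mkℝ (λ k → ℚ.- seq x k) (neg-cauchy {seq x} (cauchy x))

_-_ : ℝ → ℝ → ℝ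
x - y = x + neg y

_^_ : ℝ → ℕ → ℝ
x ^ zero  = 1ℝ
x ^ suc k = x * x ^ k

------------------------------------------------------------------------
-- Natural logarithm of a natural number

harmonic : ℕ → ℚ
harmonic zero    = 0ℚ
harmonic (suc k) = harmonic k ℚ.+ + 1 ℚ./ suc k

lnSeq : ℕ → ℕ → ℚ
lnSeq n k = harmonic (n ℕ.* suc k) ℚ.- harmonic (suc k)

module LogarithmLemmas where
  inv : ℕ → ℚ
  inv k = + 1 ℚ./ suc k

  toℚᵘ-/ : ∀ i k → ℚ.toℚᵘ (+ i ℚ./ suc k) ℚᵘ.≃ mkℚᵘ (+ i) k
  toℚᵘ-/ i k = ℚ.toℚᵘ-fromℚᵘ (mkℚᵘ (+ i) k)

  inv-antimono : ∀ {j k} → j ℕ.≤ k → inv k ℚ.≤ inv j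
  inv-antimono {j} {k} j≤k = ℚ.toℚᵘ-cancel-≤ (begin
      ℚ.toℚᵘ (inv k)  ≃⟨ toℚᵘ-/ 1 k ⟩
      mkℚᵘ (+ 1) k    ≤⟨ ℚᵘ.*≤* (ℤ.*-monoˡ-≤-nonNeg (+ 1) (ℤ.+≤+ (ℕ.s≤s j≤k))) ⟩
      mkℚᵘ (+ 1) j    ≃⟨ toℚᵘ-/ 1 j ⟨
      ℚ.toℚᵘ (inv j)  ∎)
    where open ℚᵘ.≤-Reasoning

  inv-nonNeg : ∀ k → 0ℚ ℚ.≤ inv k
  inv-nonNeg k = ℚ.toℚᵘ-cancel-≤ (begin
      ℚ.toℚᵘ 0ℚ       ≤⟨ ℚᵘ.*≤* (ℤ.+≤+ ℕ.z≤n) ⟩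
      mkℚᵘ (+ 1) k    ≃⟨ toℚᵘ-/ 1 k ⟨
      ℚ.toℚᵘ (inv k)  ∎)
    where open ℚᵘ.≤-Reasoning

  archimedean : ∀ ε → 0ℚ ℚ.< ε → ∃[ N ] inv N ℚ.< ε
  archimedean (mkℚ (+ zero) d c) (ℚ.*<* (ℤ.+<+ ()))
  archimedean (mkℚ ℤ.-[1+ n ] d c) (ℚ.*<* ())
  archimedean ε@(mkℚ ℤ.+[1+ n ] d c) _ = suc d , ℚ.toℚᵘ-cancel-< (begin-strict
      ℚ.toℚᵘ (inv (suc d))  ≃⟨ toℚᵘ-/ 1 (suc d) ⟩
      mkℚᵘ (+ 1) (suc d)    <⟨ ℚᵘ.*<* (ℤ.+<+ lt) ⟩
      mkℚᵘ (+ suc n) d      ∎)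
    where
    open ℚᵘ.≤-Reasoning
    lt : 1 ℕ.* suc d ℕ.< suc n ℕ.* suc (suc d)
    lt = ℕ.<-≤-trans (subst (ℕ._< suc (suc d)) (sym (ℕ.*-identityˡ (suc d))) (ℕ.n<1+n _))
                     (ℕ.m≤m+n (suc (suc d)) (n ℕ.* suc (suc d)))

  *-inv : ∀ p k → (+ suc p ℚ./ 1) ℚ.* inv (ℕ.pred (suc p ℕ.* suc k)) ≡ inv k
  *-inv p k = ℚ.toℚᵘ-injective (begin-equality
      ℚ.toℚᵘ ((+ suc p ℚ./ 1) ℚ.* inv l)
        ≃⟨ ℚ.toℚᵘ-homo-* (+ suc p ℚ./ 1) (inv l) ⟩
      ℚ.toℚᵘ (+ suc p ℚ./ 1) ℚᵘ.* ℚ.toℚᵘ (inv l)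
        ≃⟨ ℚᵘ.*-cong (toℚᵘ-/ (suc p) 0) (toℚᵘ-/ 1 l) ⟩
      mkℚᵘ (+ suc p) 0 ℚᵘ.* mkℚᵘ (+ 1) l
        ≃⟨ ℚᵘ.*≡* (cong +_ (eq (suc p) (suc k))) ⟩
      mkℚᵘ (+ 1) k
        ≃⟨ toℚᵘ-/ 1 k ⟨
      ℚ.toℚᵘ (inv k) ∎)
    where
    open ℚᵘ.≤-Reasoning
    l = ℕ.pred (suc p ℕ.* suc k)
    eq : ∀ a b → a ℕ.* 1 ℕ.* b ≡ 1 ℕ.* (1 ℕ.* (a ℕ.* b))
    eq = solve-∀

  suc-* : ∀ i q → (+ suc i ℚ./ 1) ℚ.* q ≡ (+ i ℚ./ 1) ℚ.* q ℚ.+ q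
  suc-* i q = trans (cong (ℚ._* q) (ℚ.toℚᵘ-injective (begin-equality
      ℚ.toℚᵘ (+ suc i ℚ./ 1)                    ≃⟨ toℚᵘ-/ (suc i) 0 ⟩
      mkℚᵘ (+ suc i) 0                          ≃⟨ ℚᵘ.*≡* (eq (+ i)) ⟩
      mkℚᵘ (+ i) 0 ℚᵘ.+ ℚᵘ.1ℚᵘ                  ≃⟨ ℚᵘ.+-congˡ ℚᵘ.1ℚᵘ (toℚᵘ-/ i 0) ⟨
      ℚ.toℚᵘ (+ i ℚ./ 1) ℚᵘ.+ ℚ.toℚᵘ 1ℚ         ≃⟨ ℚ.toℚᵘ-homo-+ (+ i ℚ./ 1) 1ℚ ⟨
      ℚ.toℚᵘ ((+ i ℚ./ 1) ℚ.+ 1ℚ)               ∎)))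
      (identity₅ (+ i ℚ./ 1) q)
    where
    open ℚᵘ.≤-Reasoning
    eq : ∀ a → (ℤ.1ℤ ℤ.+ a) ℤ.* ℤ.1ℤ ≡ (a ℤ.* ℤ.1ℤ ℤ.+ ℤ.1ℤ ℤ.* ℤ.1ℤ) ℤ.* ℤ.1ℤ
    eq = ℤ.solve-∀

  harmonic-lower : ∀ j i M → j ℕ.+ i ℕ.≤ suc M →
    harmonic j ℚ.+ (+ i ℚ./ 1) ℚ.* inv M ℚ.≤ harmonic (j ℕ.+ i)
  harmonic-lower j zero M _ = ℚ.≤-reflexive
    (trans (trans (cong (harmonic j ℚ.+_) (ℚ.*-zeroˡ (inv M))) (ℚ.+-identityʳ (harmonic j)))
           (cong harmonic (sym (ℕ.+-identityʳ j))))
  harmonic-lower j (suc i) M le rewrite ℕ.+-suc j i = begin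
      harmonic j ℚ.+ (+ suc i ℚ./ 1) ℚ.* inv M
        ≡⟨ cong (harmonic j ℚ.+_) (suc-* i (inv M)) ⟩
      harmonic j ℚ.+ ((+ i ℚ./ 1) ℚ.* inv M ℚ.+ inv M)
        ≡⟨ ℚ.+-assoc (harmonic j) _ (inv M) ⟨
      harmonic j ℚ.+ (+ i ℚ./ 1) ℚ.* inv M ℚ.+ inv M
        ≤⟨ ℚ.+-mono-≤ (harmonic-lower j i M (ℕ.≤-trans (ℕ.n≤1+n _) le))
                      (inv-antimono (ℕ.s≤s⁻¹ le)) ⟩
      harmonic (j ℕ.+ i) ℚ.+ inv (j ℕ.+ i) ∎
    where open ℚ.≤-Reasoning

  harmonic-upper : ∀ j i M → M ℕ.≤ j →
    harmonic (j ℕ.+ i) ℚ.≤ harmonic j ℚ.+ (+ i ℚ./ 1) ℚ.* inv M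
  harmonic-upper j zero M _ = ℚ.≤-reflexive (sym
    (trans (trans (cong (harmonic j ℚ.+_) (ℚ.*-zeroˡ (inv M))) (ℚ.+-identityʳ (harmonic j)))
           (cong harmonic (sym (ℕ.+-identityʳ j)))))
  harmonic-upper j (suc i) M le rewrite ℕ.+-suc j i = begin
      harmonic (j ℕ.+ i) ℚ.+ inv (j ℕ.+ i)
        ≤⟨ ℚ.+-mono-≤ (harmonic-upper j i M le)
                      (inv-antimono (ℕ.≤-trans le (ℕ.m≤m+n j i))) ⟩
      harmonic j ℚ.+ (+ i ℚ./ 1) ℚ.* inv M ℚ.+ inv M
        ≡⟨ ℚ.+-assoc (harmonic j) _ (inv M) ⟩
      harmonic j ℚ.+ ((+ i ℚ./ 1) ℚ.* inv M ℚ.+ inv M)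
        ≡⟨ cong (harmonic j ℚ.+_) (suc-* i (inv M)) ⟨
      harmonic j ℚ.+ (+ suc i ℚ./ 1) ℚ.* inv M ∎
    where open ℚ.≤-Reasoning

  *-suc-split : ∀ p k → suc p ℕ.* suc (suc k) ≡ suc p ℕ.* suc k ℕ.+ suc p
  *-suc-split p k = trans (ℕ.*-suc (suc p) (suc k)) (ℕ.+-comm (suc p) (suc p ℕ.* suc k))

  lnSeq-increasing : ∀ p k → lnSeq (suc p) k ℚ.≤ lnSeq (suc p) (suc k)
  lnSeq-increasing p k = begin
      h ℚ.- harmonic (suc k)
        ≡⟨ identity₆ h (harmonic (suc k)) (inv (suc k)) ⟩
      (h ℚ.+ inv (suc k)) ℚ.- harmonic (suc (suc k))
        ≤⟨ ℚ.+-monoˡ-≤ (ℚ.- harmonic (suc (suc k))) step ⟩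
      harmonic (suc p ℕ.* suc (suc k)) ℚ.- harmonic (suc (suc k)) ∎
    where
    open ℚ.≤-Reasoning
    h = harmonic (suc p ℕ.* suc k)
    step : h ℚ.+ inv (suc k) ℚ.≤ harmonic (suc p ℕ.* suc (suc k))
    step = subst₂ ℚ._≤_ (cong (h ℚ.+_) (*-inv p (suc k))) (cong harmonic (sym (*-suc-split p k)))
      (harmonic-lower (suc p ℕ.* suc k) (suc p) (ℕ.pred (suc p ℕ.* suc (suc k)))
        (ℕ.≤-reflexive (sym (*-suc-split p k))))

  lnSeq-decreasing : ∀ p k →
    lnSeq (suc p) (suc k) ℚ.+ inv (suc k) ℚ.≤ lnSeq (suc p) k ℚ.+ inv k
  lnSeq-decreasing p k = begin
      harmonic (suc p ℕ.* suc (suc k)) ℚ.- (harmonic (suc k) ℚ.+ inv (suc k)) ℚ.+ inv (suc k)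
        ≡⟨ identity₇
             (harmonic (suc p ℕ.* suc (suc k))) (harmonic (suc k)) (inv (suc k)) ⟩
      harmonic (suc p ℕ.* suc (suc k)) ℚ.- harmonic (suc k)
        ≤⟨ ℚ.+-monoˡ-≤ (ℚ.- harmonic (suc k)) step ⟩
      h ℚ.+ inv k ℚ.- harmonic (suc k)
        ≡⟨ identity₈ h (inv k) (harmonic (suc k)) ⟩
      h ℚ.- harmonic (suc k) ℚ.+ inv k ∎
    where
    open ℚ.≤-Reasoning
    h = harmonic (suc p ℕ.* suc k)
    step : harmonic (suc p ℕ.* suc (suc k)) ℚ.≤ h ℚ.+ inv k
    step = subst₂ ℚ._≤_ (cong harmonic (sym (*-suc-split p k))) (cong (h ℚ.+_) (*-inv p k))
      (harmonic-upper (suc p ℕ.* suc k) (suc p) (ℕ.pred (suc p ℕ.* suc k)) (ℕ.pred[n]≤n))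

  module Monotone (f : ℕ → ℚ)
    (inc : ∀ k → f k ℚ.≤ f (suc k))
    (dec : ∀ k → f (suc k) ℚ.+ inv (suc k) ℚ.≤ f k ℚ.+ inv k) where

    inc* : ∀ N i → f N ℚ.≤ f (i ℕ.+ N)
    inc* N zero    = ℚ.≤-refl
    inc* N (suc i) = ℚ.≤-trans (inc* N i) (inc (i ℕ.+ N))

    dec* : ∀ N i → f (i ℕ.+ N) ℚ.+ inv (i ℕ.+ N) ℚ.≤ f N ℚ.+ inv N
    dec* N zero    = ℚ.≤-refl
    dec* N (suc i) = ℚ.≤-trans (dec (i ℕ.+ N)) (dec* N i)

    lower : ∀ {N m} → N ℕ.≤ m → f N ℚ.≤ f m
    lower {N} {m} N≤m = subst (λ x → f N ℚ.≤ f x) (ℕ.m∸n+n≡m N≤m) (inc* N (m ℕ.∸ N))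

    upper : ∀ {N m} → N ℕ.≤ m → f m ℚ.≤ f N ℚ.+ inv N
    upper {N} {m} N≤m = begin
        f m              ≡⟨ ℚ.+-identityʳ (f m) ⟨
        f m ℚ.+ 0ℚ       ≤⟨ ℚ.+-monoʳ-≤ (f m) (inv-nonNeg m) ⟩
        f m ℚ.+ inv m    ≤⟨ subst (λ x → f x ℚ.+ inv x ℚ.≤ f N ℚ.+ inv N)
                              (ℕ.m∸n+n≡m N≤m) (dec* N (m ℕ.∸ N)) ⟩
        f N ℚ.+ inv N    ∎
      where open ℚ.≤-Reasoning

    gap : ∀ {N m n} → N ℕ.≤ m → N ℕ.≤ n → f m ℚ.- f n ℚ.≤ inv N
    gap {N} {m} {n} N≤m N≤n = begin
        f m ℚ.- f n                ≤⟨ ℚ.+-mono-≤ (upper N≤m) (ℚ.neg-antimono-≤ (lower N≤n)) ⟩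
        f N ℚ.+ inv N ℚ.- f N      ≡⟨ identity₉ (f N) (inv N) ⟩
        inv N                      ∎
      where open ℚ.≤-Reasoning

    isCauchy : IsCauchy f
    isCauchy ε 0<ε with archimedean ε 0<ε
    ... | N , invN<ε = N , λ {m} {n} p q → ℚ.≤-<-trans (abs p q) invN<ε
      where
      abs : ∀ {m n} → N ℕ.≤ m → N ℕ.≤ n → ∣ f m ℚ.- f n ∣ ℚ.≤ inv N
      abs {m} {n} p q with ℚ.∣p∣≡p∨∣p∣≡-p (f m ℚ.- f n)
      ... | inj₁ eq = subst (ℚ._≤ inv N) (sym eq) (gap p q)
      ... | inj₂ eq = subst (ℚ._≤ inv N)
        (sym (trans eq (identity₁₀ (f m) (f n)))) (gap q p)

open LogarithmLemmas

-- lnSeq n k = Σ 1/i over (k+1) < i ≤ n(k+1), a lower Riemann sum of ∫₁ⁿ dx/x with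
-- mesh 1/(k+1); hence ln n is its limit. The value at 0 is a junk value.
ln : ℕ → ℝ
ln zero    = 0ℝ
ln (suc p) = mkℝ (lnSeq (suc p))
  (Monotone.isCauchy (lnSeq (suc p)) (lnSeq-increasing p) (lnSeq-decreasing p))

------------------------------------------------------------------------
-- Half-spaces and polytopes

Point : ℕ → Set
Point d = Vector ℝ d

infix 4 _≈ᴾ_
_≈ᴾ_ : ∀ {d} → Point d → Point d → Set
_≈ᴾ_ = Pointwise _≈_

Region : ℕ → Set₁
Region d = Pred (Point d) 0ℓ

⟨_,_⟩ : ∀ {d} → Point d → Point d → ℝ
⟨ a , x ⟩ = foldr _+_ 0ℝ (zipWith _*_ a x)

-- Both closed and open half-spaces are admitted.
IsHalfSpace : ∀ {d} → Region d → Set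
IsHalfSpace {d} S = ∃₂ λ (a : Point d) (b : ℝ) →
  ¬ (∀ i → a i ≈ 0ℝ) ×
  (S ≐ (λ x → ⟨ a , x ⟩ ≤ b) ⊎ S ≐ (λ x → ⟨ a , x ⟩ < b))

translate : ∀ {d} → Point d → Region d → Region d
translate v S x = zipWith _-_ x v ∈ S

-- Finite intersections of translates. The same H i may be used several times, with
-- different translations, or not at all; the empty intersection is the whole space.
IsIntersectionOfTranslates : ∀ {d s} → (Fin s → Region d) → Region d → Set
IsIntersectionOfTranslates {d} {s} H P =
  ∃ λ (L : List (Fin s × Point d)) →
    P ≐ (λ x → All (λ (i , v) → x ∈ translate v (H i)) L)

------------------------------------------------------------------------
-- Graphs

record Graph : Set₁ where
  field
    Vertex   : Set
    _~_      : Vertex → Vertex → Set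
    ~-sym    : ∀ {u v} → u ~ v → v ~ u
    ~-irrefl : ∀ {v} → ¬ (v ~ v)

bipartite : (A B : Set) → (A → B → Set) → Graph
bipartite A B R = record
  { Vertex = A ⊎ B
  ; _~_ = adj
  ; ~-sym = λ {u} {v} → adj-sym u v
  ; ~-irrefl = λ {v} → adj-irrefl v
  }
  where
  adj : A ⊎ B → A ⊎ B → Set
  adj (inj₁ a) (inj₂ b) = R a b
  adj (inj₂ b) (inj₁ a) = R a b
  adj (inj₁ _) (inj₁ _) = ⊥
  adj (inj₂ _) (inj₂ _) = ⊥
  adj-sym : ∀ u v → adj u v → adj v u
  adj-sym (inj₁ _) (inj₂ _) r = r
  adj-sym (inj₂ _) (inj₁ _) r = r
  adj-irrefl : ∀ v → ¬ adj v v
  adj-irrefl (inj₁ _) ()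
  adj-irrefl (inj₂ _) ()

completeBipartite : ℕ → ℕ → Graph
completeBipartite m n = bipartite (Fin m) (Fin n) (λ _ _ → ⊤)

incidenceGraph : ∀ {d m n} → (Fin m → Point d) → (Fin n → Region d) → Graph
incidenceGraph {m = m} {n} X Q = bipartite (Fin m) (Fin n) (λ i j → X i ∈ Q j)

-- Not necessarily induced.
HasSubgraph : Graph → Graph → Set
HasSubgraph G K = ∃ λ (f : K.Vertex → G.Vertex) →
    Injective _≡_ _≡_ f × (∀ {u v} → u K.~ v → f u G.~ f v)
  where
  module G = Graph G
  module K = Graph K

-- A finite set of edges, each an unordered pair listed in one of its two orders.
IsEdgeSet : (G : Graph) → List (Graph.Vertex G × Graph.Vertex G) → Set
IsEdgeSet G es = All (uncurry _~_) es × AllPairs DistinctEdges es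
  where
  open Graph G
  DistinctEdges : Vertex × Vertex → Vertex × Vertex → Set
  DistinctEdges (u , v) (u′ , v′) = ¬ ((u ≡ u′ × v ≡ v′) ⊎ (u ≡ v′ × v ≡ u′))

-- Adjacency need not be decidable, so the edges are counted through their finite sets.
AtMostEdges : Graph → ℝ → Set
AtMostEdges G r = ∀ es → IsEdgeSet G es → fromℕ (length es) ≤ r

{-# OPTIONS --safe #-}
-- The conclusion is a negation about finitely many points and polytopes, so membership may be
-- decided classically and all real data replaced by one late term of their Cauchy sequences:
-- only the finitely many strict inequalities that separate the points of X have to survive.
--
-- Over ℚ, call a relation S good with constant B if K_{t,t}-free parts of S on vertex sets ps, qs
-- have at most B (|ps| + |qs|) edges. The full relation is good with constant t, and intersecting
-- with a relation f p ≤ c q costs a factor log n by halving the range of ranks. To use only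
-- min (2d, s) such intersections, split each polytope as in Fourier–Motzkin elimination: for every
-- coordinate and sign, select the constraint of least slack in that direction; it implies the
-- others once its slack has been compared with theirs, and these comparisons no longer involve
-- the coordinate. There are at most 2^s choices each time.

module Submission where

open import Defs
open import Data.Empty using (⊥)
open import Data.Fin.Base as Fin using (Fin; zero; suc)
import Data.Fin.Properties as Fin
open import Data.Integer.Base as ℤ using (+_)
import Data.Integer.Properties as ℤ
open import Data.List.Base using (List; []; _∷_; length; lookup; filter; allFin; tabulate; cartesianProduct; map)
open import Data.List.Membership.Propositional using () renaming (_∈_ to _∈ˡ_)
open import Data.List.Membership.Propositional.Properties
  using (∈-filter⁺; ∈-filter⁻; ∈-cartesianProduct⁺; ∈-allFin; ∈-lookup)
import Data.List.Properties as List
open import Data.List.Relation.Binary.Pointwise using (Pointwise; []; _∷_; Pointwise-length)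
open import Data.List.Relation.Binary.Sublist.Propositional using ([]; _∷_; _∷ʳ_) renaming (_⊆_ to _⊑_)
open import Data.List.Relation.Binary.Sublist.Propositional.Properties using (All-resp-⊆)
open import Data.List.Relation.Unary.All as All using (All; []; _∷_)
import Data.List.Relation.Unary.All.Properties as All
open import Data.List.Relation.Unary.AllPairs using ([]; _∷_)
open import Data.List.Relation.Unary.Any using (here; there; index)
open import Data.List.Relation.Unary.Any.Properties using (lookup-index)
open import Data.List.Relation.Unary.Unique.Propositional using (Unique)
import Data.List.Relation.Unary.Unique.Propositional.Properties as Unique
open import Data.Nat.Base as ℕ using (ℕ; zero; suc)
import Data.Nat.Properties as ℕ
open import Data.Nat.Tactic.RingSolver using (solve-∀)
open import Data.Product using (_×_; _,_; ∃; ∃₂; ∃-syntax; proj₁; proj₂; uncurry)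
open import Data.Rational.Base as ℚ using (ℚ; 0ℚ; 1ℚ; ½)
import Data.Rational.Properties as ℚ
open import Data.Rational.Solver using (module +-*-Solver)
open import Data.Rational.Unnormalised.Base as ℚᵘ using (mkℚᵘ)
import Data.Rational.Unnormalised.Properties as ℚᵘ
open import Data.Sum.Base as Sum using (_⊎_; inj₁; inj₂)
import Data.Sum.Properties as Sum
open import Data.Unit.Base using (⊤; tt)
open import Data.Vec.Functional using (zipWith)
open import Effect.Monad using (RawMonad)
open import Function.Base using (_∘_; id)
open import Function.Definitions using (Injective)
open import Level using (0ℓ)
open import Relation.Binary.Core using (REL)
open import Relation.Binary.PropositionalEquality
  using (_≡_; refl; sym; trans; cong; cong₂; subst; subst₂)
open import Relation.Nullary using (¬_; Dec; yes; no; contradiction)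
open import Relation.Nullary.Decidable using (¬¬-excluded-middle)
open import Relation.Nullary.Negation using (¬¬-Monad; ¬¬-map)
open import Relation.Unary using (Pred; Decidable; _≐_)
open import Relation.Unary.Properties using (∁?)

open LogarithmLemmas
open +-*-Solver using (solve; _:+_; _:*_; _:-_; :-_; _:=_; con)

-- Counting in lists without repetition.

private
  variable
    A P Q : Set

lookup-injective : {xs : List A} → Unique xs → Injective _≡_ _≡_ (lookup xs)
lookup-injective (_ ∷ _)  {zero}  {zero}  _  = refl
lookup-injective (x∉ ∷ _) {zero}  {suc j} eq = contradiction eq (All.lookup x∉ (∈-lookup j))
lookup-injective (x∉ ∷ _) {suc i} {zero}  eq = contradiction (sym eq) (All.lookup x∉ (∈-lookup i))
lookup-injective (_ ∷ u)  {suc i} {suc j} eq = cong suc (lookup-injective u eq)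

distinct : {xs : List A} {t : ℕ} → Unique xs → t ℕ.≤ length xs →
  ∃ λ (f : Fin t → A) → Injective _≡_ _≡_ f × (∀ i → f i ∈ˡ xs)
distinct {xs = xs} u t≤ = (λ i → lookup xs (Fin.inject≤ i t≤)) ,
  (λ eq → Fin.inject≤-injective t≤ t≤ _ _ (lookup-injective u eq)) , (λ i → ∈-lookup (Fin.inject≤ i t≤))

-- Pigeonhole: equal positions in `ys` give equal entries, and `xs` repeats none.
length-⊆ : {xs ys : List A} → Unique xs → All (_∈ˡ ys) xs → length xs ℕ.≤ length ys
length-⊆ {xs = xs} {ys} u xs⊆ys = Fin.injective⇒≤ {f = position} λ {i} {j} eq →
  lookup-injective {xs = xs} u (trans (lookup-index (mem i)) (trans (cong (lookup ys) eq) (sym (lookup-index (mem j)))))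
  where
  mem : ∀ i → lookup xs i ∈ˡ ys
  mem i = All.lookup xs⊆ys (∈-lookup i)
  position : Fin (length xs) → Fin (length ys)
  position i = index (mem i)

length-cartesianProduct : (xs : List P) (ys : List Q) →
  length (cartesianProduct xs ys) ≡ length xs ℕ.* length ys
length-cartesianProduct []       ys = refl
length-cartesianProduct (x ∷ xs) ys = trans (List.length-++ (map (x ,_) ys))
  (cong₂ ℕ._+_ (List.length-map (x ,_) ys) (length-cartesianProduct xs ys))

length-filter-∁ : {R : Pred A 0ℓ} (R? : Decidable R) (xs : List A) →
  length xs ≡ length (filter R? xs) ℕ.+ length (filter (∁? R?) xs)
length-filter-∁ R? []       = refl
length-filter-∁ R? (x ∷ xs) with R? x
... | yes _ = cong suc (length-filter-∁ R? xs)
... | no _  = trans (cong suc (length-filter-∁ R? xs)) (sym (ℕ.+-suc _ _))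

Unique-resp-⊑ : {xs ys : List A} → xs ⊑ ys → Unique ys → Unique xs
Unique-resp-⊑ []         []       = []
Unique-resp-⊑ (_ ∷ʳ τ)   (_ ∷ u)  = Unique-resp-⊑ τ u
Unique-resp-⊑ (refl ∷ τ) (y∉ ∷ u) = All-resp-⊆ τ y∉ ∷ Unique-resp-⊑ τ u

All-⊎-split : {R R₁ R₂ : Pred A 0ℓ} → (∀ {x} → R x → R₁ x ⊎ R₂ x) → (xs : List A) → All R xs →
  ∃₂ λ ys zs → ys ⊑ xs × zs ⊑ xs × All R₁ ys × All R₂ zs × length xs ≡ length ys ℕ.+ length zs
All-⊎-split split []       []         = [] , [] , [] , [] , [] , [] , refl
All-⊎-split split (x ∷ xs) (rx ∷ rxs) with split rx | All-⊎-split split xs rxs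
... | inj₁ r | ys , zs , σ , τ , as , bs , eq =
  x ∷ ys , zs , refl ∷ σ , x ∷ʳ τ , r ∷ as , bs , cong suc eq
... | inj₂ r | ys , zs , σ , τ , as , bs , eq =
  ys , x ∷ zs , x ∷ʳ σ , refl ∷ τ , as , r ∷ bs , trans (cong suc eq) (sym (ℕ.+-suc _ _))

-- Bipartite graphs without K_{t,t}

-- Counting through duplicate-free lists needs no decision procedure for `R` and matches
-- `AtMostEdges`.
Bounded : REL P Q 0ℓ → ℕ → Set
Bounded R B = ∀ es → Unique es → All (uncurry R) es → length es ℕ.≤ B

Bounded-∪ : {R R₁ R₂ : REL P Q 0ℓ} {B₁ B₂ : ℕ} → (∀ {p q} → R p q → R₁ p q ⊎ R₂ p q) →
  Bounded R₁ B₁ → Bounded R₂ B₂ → Bounded R (B₁ ℕ.+ B₂)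
Bounded-∪ split b₁ b₂ es u rs with All-⊎-split split es rs
... | ys , zs , σ , τ , as , bs , eq = subst (ℕ._≤ _) (sym eq)
  (ℕ.+-mono-≤ (b₁ ys (Unique-resp-⊑ σ u) as) (b₂ zs (Unique-resp-⊑ τ u) bs))

Bounded-mono : {R R′ : REL P Q 0ℓ} {B B′ : ℕ} → (∀ {p q} → R′ p q → R p q) → B ℕ.≤ B′ →
  Bounded R B → Bounded R′ B′
Bounded-mono R′⇒R B≤B′ b es u rs = ℕ.≤-trans (b es u (All.map R′⇒R rs)) B≤B′

record KFree (t : ℕ) (R : REL P Q 0ℓ) : Set where
  constructor kFree
  field
    no-K : (f : Fin t → P) (g : Fin t → Q) → Injective _≡_ _≡_ f → Injective _≡_ _≡_ g →
      ¬ (∀ i j → R (f i) (g j))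

KFree-mono : ∀ {t} {R R′ : REL P Q 0ℓ} → (∀ {p q} → R′ p q → R p q) → KFree t R → KFree t R′
KFree-mono R′⇒R (kFree no-K) = kFree λ f g fi gi k → no-K f g fi gi λ i j → R′⇒R (k i j)

module _ {P Q : Set} where

  Rect : List P → List Q → REL P Q 0ℓ → REL P Q 0ℓ
  Rect ps qs S p q = p ∈ˡ ps × q ∈ˡ qs × S p q

  module Linear (t : ℕ) where

    -- The hypothesis is on all pairs of vertex sets, so that a bound survives
    -- intersecting S with further relations.
    record Good (S : REL P Q 0ℓ) (B : ℕ) : Set where
      field
        bounded : ∀ ps qs → Unique ps → Unique qs → KFree t (Rect ps qs S) →
          Bounded (Rect ps qs S) (B ℕ.* (length ps ℕ.+ length qs))

    open Good

    -- All pairs are present, so `t` distinct vertices on each side would form a K_{t,t}. Hence one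
    -- side has fewer than `t` vertices, and the product of the two lengths is at most `t` times
    -- their sum.
    Good-⊤ : {S : REL P Q 0ℓ} → (∀ p q → S p q) → Good S t
    bounded (Good-⊤ {S} all) ps qs ups uqs free es ues res = ℕ.≤-trans
      (subst (length es ℕ.≤_) (length-cartesianProduct ps qs)
        (length-⊆ ues (All.map (λ (p∈ , q∈ , _) → ∈-cartesianProduct⁺ p∈ q∈) res)))
      small
      where
      small : length ps ℕ.* length qs ℕ.≤ t ℕ.* (length ps ℕ.+ length qs)
      small with t ℕ.≤? length ps | t ℕ.≤? length qs
      ... | no t≰ | _ = ℕ.*-mono-≤ (ℕ.<⇒≤ (ℕ.≰⇒> t≰)) (ℕ.m≤n+m (length qs) (length ps))
      ... | _ | no t≰ = ℕ.≤-trans (ℕ.≤-reflexive (ℕ.*-comm (length ps) (length qs)))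
        (ℕ.*-mono-≤ (ℕ.<⇒≤ (ℕ.≰⇒> t≰)) (ℕ.m≤m+n (length ps) (length qs)))
      ... | yes t≤p | yes t≤q with distinct ups t≤p | distinct uqs t≤q
      ...   | f , fi , f∈ | g , gi , g∈ =
        contradiction (λ i j → f∈ i , g∈ j , all _ _) (KFree.no-K free f g fi gi)

    Good-mono : {S : REL P Q 0ℓ} {B B′ : ℕ} → B ℕ.≤ B′ → Good S B → Good S B′
    bounded (Good-mono B≤B′ good) ps qs ups uqs free =
      Bounded-mono id (ℕ.*-monoˡ-≤ (length ps ℕ.+ length qs) B≤B′) (bounded good ps qs ups uqs free)

    -- Both parts lie inside `S` and so inherit K_{t,t}-freeness; their edge counts add up.
    Good-∪ : {S S₁ S₂ : REL P Q 0ℓ} {B₁ B₂ : ℕ} →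
      (∀ {p q} → S p q → S₁ p q ⊎ S₂ p q) →
      (∀ {p q} → S₁ p q → S p q) → (∀ {p q} → S₂ p q → S p q) →
      Good S₁ B₁ → Good S₂ B₂ → Good S (B₁ ℕ.+ B₂)
    bounded (Good-∪ {S} {S₁} {S₂} {B₁} {B₂} split ⊆₁ ⊆₂ good₁ good₂) ps qs ups uqs free =
      Bounded-mono id (ℕ.≤-reflexive (sym (ℕ.*-distribʳ-+ (length ps ℕ.+ length qs) B₁ B₂)))
        (Bounded-∪ {R₁ = Rect ps qs S₁} {R₂ = Rect ps qs S₂} cover
          (bounded good₁ ps qs ups uqs (KFree-mono (λ (a , b , s) → a , b , ⊆₁ s) free))
          (bounded good₂ ps qs ups uqs (KFree-mono (λ (a , b , s) → a , b , ⊆₂ s) free)))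
      where
      cover : ∀ {p q} → Rect ps qs S p q → Rect ps qs S₁ p q ⊎ Rect ps qs S₂ p q
      cover (a , b , s) with split s
      ... | inj₁ s₁ = inj₁ (a , b , s₁)
      ... | inj₂ s₂ = inj₂ (a , b , s₂)

    Good-⇔ : {S S′ : REL P Q 0ℓ} {B : ℕ} → (∀ {p q} → S p q → S′ p q) → (∀ {p q} → S′ p q → S p q) →
      Good S B → Good S′ B
    bounded (Good-⇔ ⇒ ⇐ good) ps qs ups uqs free =
      Bounded-mono (λ (a , b , s) → a , b , ⇐ s) ℕ.≤-refl
        (bounded good ps qs ups uqs (KFree-mono (λ (a , b , s) → a , b , ⇒ s) free))

    -- A condition on `q` alone costs nothing: delete the vertices of `qs` that violate it.
    Good-∩ʳ : {S : REL P Q 0ℓ} {B : ℕ} {T : Pred Q 0ℓ} → Decidable T →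
      Good S B → Good (λ p q → S p q × T q) B
    bounded (Good-∩ʳ {S} {B} {T} T? good) ps qs ups uqs free = Bounded-mono
      (λ (p∈ , q∈ , s , t) → p∈ , ∈-filter⁺ T? q∈ t , s)
      (ℕ.*-monoʳ-≤ B (ℕ.+-monoʳ-≤ (length ps) (List.length-filter T? qs)))
      (bounded good ps (filter T? qs) ups (Unique.filter⁺ T? uqs) (KFree-mono widen free))
      where
      widen : ∀ {p q} → Rect ps (filter T? qs) S p q → Rect ps qs (λ p q → S p q × T q) p q
      widen (p∈ , q∈ , s) with ∈-filter⁻ T? q∈
      ... | q∈qs , t = p∈ , q∈qs , s , t

    module _ {S : REL P Q 0ℓ} {B : ℕ} (good : Good S B) (f : P → ℕ) (g : Q → ℕ) where

      S< : REL P Q 0ℓ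
      S< p q = S p q × f p ℕ.< g q

      -- Halving the interval of ranks: an edge with f p < mid ≤ g q satisfies f p < g q for free,
      -- and the remaining edges lie in the two halves.
      Good-<-interval : ∀ L lo ps qs → Unique ps → Unique qs →
        (∀ {p} → p ∈ˡ ps → lo ℕ.≤ f p) → (∀ {q} → q ∈ˡ qs → g q ℕ.< lo ℕ.+ 2 ℕ.^ L) →
        KFree t (Rect ps qs S<) → Bounded (Rect ps qs S<) (B ℕ.* L ℕ.* (length ps ℕ.+ length qs))
      Good-<-interval zero lo ps qs _ _ lo≤f g<hi _ [] _ _ = ℕ.z≤n
      -- An edge over an interval of length one would give `lo ≤ f p < g q < lo + 1`.
      Good-<-interval zero lo ps qs _ _ lo≤f g<hi _ (_ ∷ _) _ ((p∈ , q∈ , _ , f<g) ∷ _) =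
        contradiction (ℕ.≤-trans (ℕ.s≤s (lo≤f p∈)) f<g)
          (ℕ.<⇒≱ (ℕ.<-≤-trans (g<hi q∈) (ℕ.≤-reflexive (ℕ.+-comm lo 1))))
      Good-<-interval (suc L) lo ps qs ups uqs lo≤f g<hi free = Bounded-mono cover
        bound
        (Bounded-∪ {R₁ = Rect ps₁ qs₁ S<} id
          (Good-<-interval L lo ps₁ qs₁ (Unique.filter⁺ f<? ups) (Unique.filter⁺ g<? uqs)
            (λ p∈ → lo≤f (proj₁ (∈-filter⁻ f<? p∈))) (λ q∈ → proj₂ (∈-filter⁻ g<? {xs = qs} q∈))
            (KFree-mono (λ (p∈ , q∈ , s) → proj₁ (∈-filter⁻ f<? p∈) , proj₁ (∈-filter⁻ g<? q∈) , s) free))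
          (Bounded-∪ {R₁ = Rect ps₂ qs₂ S<} id
            (Good-<-interval L mid ps₂ qs₂ (Unique.filter⁺ (∁? f<?) ups) (Unique.filter⁺ (∁? g<?) uqs)
              (λ p∈ → ℕ.≮⇒≥ (proj₂ (∈-filter⁻ (∁? f<?) {xs = ps} p∈)))
              (λ {q} q∈ → subst (g q ℕ.<_) hi≡ (g<hi (proj₁ (∈-filter⁻ (∁? g<?) q∈))))
              (KFree-mono
                (λ (p∈ , q∈ , s) → proj₁ (∈-filter⁻ (∁? f<?) p∈) , proj₁ (∈-filter⁻ (∁? g<?) q∈) , s) free))
            (bounded good ps₁ qs₂ (Unique.filter⁺ f<? ups) (Unique.filter⁺ (∁? g<?) uqs)
              (KFree-mono (λ (p∈ , q∈ , s) → cross (∈-filter⁻ f<? p∈) (∈-filter⁻ (∁? g<?) q∈) s) free))))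
        where
        mid = lo ℕ.+ 2 ℕ.^ L
        f<? : Decidable (λ p → f p ℕ.< mid)
        f<? p = f p ℕ.<? mid
        g<? : Decidable (λ q → g q ℕ.< mid)
        g<? q = g q ℕ.<? mid
        ps₁ ps₂ : List P
        ps₁ = filter f<? ps
        ps₂ = filter (∁? f<?) ps
        qs₁ qs₂ : List Q
        qs₁ = filter g<? qs
        qs₂ = filter (∁? g<?) qs
        hi≡ : lo ℕ.+ 2 ℕ.^ suc L ≡ mid ℕ.+ 2 ℕ.^ L
        hi≡ = eq lo (2 ℕ.^ L)
          where
          eq : ∀ a b → a ℕ.+ (b ℕ.+ (b ℕ.+ 0)) ≡ (a ℕ.+ b) ℕ.+ b
          eq = solve-∀
        cross : ∀ {p q} → p ∈ˡ ps × f p ℕ.< mid → q ∈ˡ qs × ¬ (g q ℕ.< mid) → S p q → Rect ps qs S< p q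
        cross (p∈ , f<) (q∈ , g≮) s = p∈ , q∈ , s , ℕ.<-≤-trans f< (ℕ.≮⇒≥ g≮)
        cover : ∀ {p q} → Rect ps qs S< p q →
          Rect ps₁ qs₁ S< p q ⊎ Rect ps₂ qs₂ S< p q ⊎ Rect ps₁ qs₂ S p q
        cover {p} {q} (p∈ , q∈ , s , f<g) with f<? p | g<? q
        ... | yes f< | yes g< = inj₁ (∈-filter⁺ f<? p∈ f< , ∈-filter⁺ g<? q∈ g< , s , f<g)
        ... | no f≮  | no g≮  =
          inj₂ (inj₁ (∈-filter⁺ (∁? f<?) p∈ f≮ , ∈-filter⁺ (∁? g<?) q∈ g≮ , s , f<g))
        ... | yes f< | no g≮  = inj₂ (inj₂ (∈-filter⁺ f<? p∈ f< , ∈-filter⁺ (∁? g<?) q∈ g≮ , s))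
        ... | no f≮  | yes g< = contradiction (ℕ.<-trans f<g g<) f≮
        bound : B ℕ.* L ℕ.* (length ps₁ ℕ.+ length qs₁) ℕ.+
          (B ℕ.* L ℕ.* (length ps₂ ℕ.+ length qs₂) ℕ.+ B ℕ.* (length ps₁ ℕ.+ length qs₂)) ℕ.≤
          B ℕ.* suc L ℕ.* (length ps ℕ.+ length qs)
        -- The surplus `B * (b + c)` belongs to the block of `ps₂` and `qs₁`, which has no edges.
        bound rewrite length-filter-∁ f<? ps | length-filter-∁ g<? qs =
          ℕ.≤-trans (ℕ.m≤m+n _ _)
            (ℕ.≤-reflexive (eq B L (length ps₁) (length ps₂) (length qs₁) (length qs₂)))
          where
          eq : ∀ B L a b c d →
            B ℕ.* L ℕ.* (a ℕ.+ c) ℕ.+ (B ℕ.* L ℕ.* (b ℕ.+ d) ℕ.+ B ℕ.* (a ℕ.+ d)) ℕ.+ B ℕ.* (b ℕ.+ c) ≡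
            B ℕ.* (1 ℕ.+ L) ℕ.* ((a ℕ.+ b) ℕ.+ (c ℕ.+ d))
          eq = solve-∀

      Good-< : ∀ {L} → (∀ q → g q ℕ.< 2 ℕ.^ L) → Good S< (B ℕ.* L)
      bounded (Good-< {L} g<2^L) ps qs ups uqs = Good-<-interval L 0 ps qs ups uqs (λ _ → ℕ.z≤n) (λ {q} _ → g<2^L q)

Good⇒Bounded : ∀ {m n t B} {S : REL (Fin m) (Fin n) 0ℓ} → Linear.Good t S B → KFree t S →
  Bounded S (B ℕ.* (m ℕ.+ n))
Good⇒Bounded {m} {n} {B = B} good free =
  Bounded-mono (λ s → ∈-allFin _ , ∈-allFin _ , s)
    (ℕ.≤-reflexive (cong₂ (λ k l → B ℕ.* (k ℕ.+ l))
      (List.length-tabulate {n = m} id) (List.length-tabulate {n = n} id)))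
    (Linear.Good.bounded good (allFin m) (allFin n) (Unique.allFin⁺ m) (Unique.allFin⁺ n)
      (KFree-mono (λ (_ , _ , s) → s) free))

-- Linear constraints over ℚ

dot : ∀ {d} → (Fin d → ℚ) → (Fin d → ℚ) → ℚ
dot {zero}  a x = 0ℚ
dot {suc d} a x = a zero ℚ.* x zero ℚ.+ dot (a ∘ suc) (x ∘ suc)

dot-combination : ∀ {d} u v (a b x : Fin d → ℚ) →
  dot (λ j → u ℚ.* b j ℚ.- v ℚ.* a j) x ≡ u ℚ.* dot b x ℚ.- v ℚ.* dot a x
dot-combination {zero}  u v a b x = base u v
  where
  base : ∀ u v → 0ℚ ≡ u ℚ.* 0ℚ ℚ.- v ℚ.* 0ℚ
  base = solve 2 (λ u v → con 0ℚ := u :* con 0ℚ :- v :* con 0ℚ) refl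
dot-combination {suc d} u v a b x =
  trans (cong ((u ℚ.* b zero ℚ.- v ℚ.* a zero) ℚ.* x zero ℚ.+_) (dot-combination u v (a ∘ suc) (b ∘ suc) (x ∘ suc)))
    (step u v (a zero) (b zero) (x zero) (dot (a ∘ suc) (x ∘ suc)) (dot (b ∘ suc) (x ∘ suc)))
  where
  step : ∀ u v a b x α β → (u ℚ.* b ℚ.- v ℚ.* a) ℚ.* x ℚ.+ (u ℚ.* β ℚ.- v ℚ.* α) ≡
    u ℚ.* (b ℚ.* x ℚ.+ β) ℚ.- v ℚ.* (a ℚ.* x ℚ.+ α)
  step = solve 7 (λ u v a b x α β → (u :* b :- v :* a) :* x :+ (u :* β :- v :* α) :=
    u :* (b :* x :+ β) :- v :* (a :* x :+ α)) refl

-- (a , c) stands for the constraint ⟨a, x⟩ ≤ c q on the point x.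
Constraint : Set → ℕ → Set
Constraint Q d = (Fin d → ℚ) × (Q → ℚ)

module _ {n : ℕ} {Q : Set} (t : ℕ) where
  open Linear {Fin n} {Q} t

  -- Values are replaced by ranks: `rank` counts the points strictly below `f p`, `rankᶜ` those at
  -- most `c q`. If `f p ≤ c q`, the second set contains the first and also `p`, so the ranks differ
  -- strictly; otherwise it lies inside the first. Ranks never exceed `n`, so `L` halvings suffice.
  Good-≤ : {S : REL (Fin n) Q 0ℓ} {B L : ℕ} → n ℕ.< 2 ℕ.^ L → (f : Fin n → ℚ) (c : Q → ℚ) →
    Good S B → Good (λ p q → S p q × f p ℚ.≤ c q) (B ℕ.* L)
  Good-≤ {L = L} n<2^L f c good =
    Good-⇔ (λ (s , r<) → s , ℚ.≮⇒≥ λ c<f → ℕ.<⇒≱ r< (rank-≥ c<f)) (λ (s , f≤c) → s , rank-< f≤c)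
      (Good-< good rank rankᶜ {L} rankᶜ<)
    where
    below? : ∀ p → Decidable (λ p′ → f p′ ℚ.< f p)
    below? p p′ = f p′ ℚ.<? f p
    below-c? : ∀ q → Decidable (λ p′ → f p′ ℚ.≤ c q)
    below-c? q p′ = f p′ ℚ.≤? c q
    rank : Fin n → ℕ
    rank p = length (filter (below? p) (allFin n))
    rankᶜ : Q → ℕ
    rankᶜ q = length (filter (below-c? q) (allFin n))
    rankᶜ< : ∀ q → rankᶜ q ℕ.< 2 ℕ.^ L
    rankᶜ< q = ℕ.≤-<-trans (List.length-filter (below-c? q) (allFin n))
      (subst (ℕ._< 2 ℕ.^ L) (sym (List.length-tabulate id)) n<2^L)
    rank-< : ∀ {p q} → f p ℚ.≤ c q → rank p ℕ.< rankᶜ q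
    rank-< {p} {q} f≤c = length-⊆
      (All.tabulate (λ {p′} p′∈ p≡p′ →
        ℚ.<-irrefl (cong f (sym p≡p′)) (proj₂ (∈-filter⁻ (below? p) {xs = allFin n} p′∈))) ∷
        Unique.filter⁺ (below? p) (Unique.allFin⁺ n))
      (∈-filter⁺ (below-c? q) (∈-allFin p) f≤c ∷
        All.tabulate (λ {p′} p′∈ → ∈-filter⁺ (below-c? q) (∈-allFin p′)
          (ℚ.≤-trans (ℚ.<⇒≤ (proj₂ (∈-filter⁻ (below? p) {xs = allFin n} p′∈))) f≤c)))
    rank-≥ : ∀ {p q} → c q ℚ.< f p → rankᶜ q ℕ.≤ rank p
    rank-≥ {p} {q} c<f = length-⊆ (Unique.filter⁺ (below-c? q) (Unique.allFin⁺ n))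
      (All.tabulate (λ {p′} p′∈ → ∈-filter⁺ (below? p) (∈-allFin p′)
        (ℚ.≤-<-trans (proj₂ (∈-filter⁻ (below-c? q) {xs = allFin n} p′∈)) c<f)))

  Holds : ∀ {d} → (Fin n → Fin d → ℚ) → Constraint Q d → REL (Fin n) Q 0ℓ
  Holds x (a , c) p q = dot a (x p) ℚ.≤ c q

  Sat : ∀ {d} → (Fin n → Fin d → ℚ) → List (Constraint Q d) → REL (Fin n) Q 0ℓ
  Sat x cs p q = All (λ k → Holds x k p q) cs

  -- Fourier-Motzkin elimination.

  module Elimination (L s₀ : ℕ) (n<2^L : n ℕ.< 2 ℕ.^ L) where

    W : ℕ
    W = 2 ℕ.^ s₀ ℕ.* L

    -- `T` restricts the normals; `h` counts the pairs of a coordinate and a sign still to be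
    -- treated. Such a pair costs a factor `W` only if it uses up a constraint, whence the exponent
    -- `h ⊓ s`. In `W`, the power of two pays for the branching and `L` for one inequality.
    Eliminable : ∀ {d} → (Fin n → Fin d → ℚ) → Pred (Fin d → ℚ) 0ℓ → ℕ → Set₁
    Eliminable x T h = ∀ cs s {S B} → All (T ∘ proj₁) cs → length cs ℕ.≤ s → s ℕ.≤ s₀ → Good S B →
      Good (λ p q → S p q × Sat x cs p q) (B ℕ.* W ℕ.^ (h ℕ.⊓ s))

    module HalfStep {d : ℕ} (x : Fin n → Fin d → ℚ) (u : (Fin d → ℚ) → ℚ) where

      -- combination i k holds iff slack i / u i ≤ slack k / u k, when u i and u k are positive.
      combination : Constraint Q d → Constraint Q d → Constraint Q d
      combination (a , c) (b , e) =
        (λ j → u a ℚ.* b j ℚ.- u b ℚ.* a j) , (λ q → u a ℚ.* e q ℚ.- u b ℚ.* c q)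

      -- Swapping `i` and `k` negates both sides of the inequality, so totality of the order on ℚ
      -- suffices.
      combination-total : ∀ i k p q → Holds x (combination i k) p q ⊎ Holds x (combination k i) p q
      combination-total (a , c) (b , e) p q
        rewrite dot-combination (u a) (u b) a b (x p) | dot-combination (u b) (u a) b a (x p)
        with ℚ.≤-total (u a ℚ.* dot b (x p) ℚ.- u b ℚ.* dot a (x p)) (u a ℚ.* e q ℚ.- u b ℚ.* c q)
      ... | inj₁ ≤ = inj₁ ≤
      ... | inj₂ ≥ = inj₂ (subst₂ ℚ._≤_ (swap (u a ℚ.* dot b (x p)) _) (swap (u a ℚ.* e q) _)
        (ℚ.neg-antimono-≤ ≥))
        where
        swap : ∀ y z → ℚ.- (y ℚ.- z) ≡ z ℚ.- y
        swap = solve 2 (λ y z → :- (y :- z) := z :- y) refl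

      -- Adding `u b` times constraint `i` to the comparison leaves `u a` times constraint `k`, and
      -- `u a` is positive.
      combination-Holds : ∀ {i k p q} → 0ℚ ℚ.< u (proj₁ i) → 0ℚ ℚ.< u (proj₁ k) →
        Holds x i p q → Holds x (combination i k) p q → Holds x k p q
      combination-Holds {a , c} {b , e} {p} {q} 0<ua 0<ub hi hik
        rewrite dot-combination (u a) (u b) a b (x p) =
        ℚ.*-cancelˡ-≤-pos (u a) {{ℚ.positive 0<ua}}
          (subst₂ ℚ._≤_ (cancel _ _) (cancel _ _)
            (ℚ.+-mono-≤ hik (ℚ.*-monoˡ-≤-nonNeg (u b) {{ℚ.nonNegative (ℚ.<⇒≤ 0<ub)}} hi)))
        where
        cancel : ∀ y z → y ℚ.- z ℚ.+ z ≡ y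
        cancel = solve 2 (λ y z → y :- z :+ z := y) refl

      module _ {T : Pred (Fin d → ℚ) 0ℓ} {h : ℕ}
        (T-combination : ∀ i k → T (proj₁ (combination i k)))
        (u-combination : ∀ i k → u (proj₁ (combination i k)) ≡ 0ℚ)
        (rest : Eliminable x (λ a → T a × u a ℚ.≤ 0ℚ) h)
        where

        T′ : Pred (Constraint Q d) 0ℓ
        T′ (a , c) = T a × u a ℚ.≤ 0ℚ

        T′-combination : ∀ i k → T′ (combination i k)
        T′-combination i k = T-combination i k , ℚ.≤-reflexive (u-combination i k)

        -- i is the constraint of least slack relative to u among those with u > 0 met so far.
        tournament : ∀ i done todo s {S B} → 0ℚ ℚ.< u (proj₁ i) → All T′ done → All (T ∘ proj₁) todo →
          length done ℕ.+ length todo ℕ.≤ s → s ℕ.≤ s₀ → Good S B →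
          Good (λ p q → S p q × Holds x i p q × Sat x done p q × Sat x todo p q)
            (B ℕ.* (2 ℕ.^ length todo ℕ.* (L ℕ.* W ℕ.^ (h ℕ.⊓ s))))
        -- Only the winner still has `u > 0`. Intersecting with it costs the factor `L`; everything
        -- in `done` is left to `rest`.
        tournament i done [] s {S} {B} 0<ui tdone [] len s≤ good =
          Good-mono (ℕ.≤-reflexive (eq B L _))
            (Good-⇔ (λ ((s , hi) , sat) → s , hi , sat , []) (λ { (s , hi , sat , []) → (s , hi) , sat })
              (rest done s tdone (ℕ.≤-trans (ℕ.m≤m+n _ _) len) s≤
                (Good-≤ n<2^L (λ p → dot (proj₁ i) (x p)) (proj₂ i) good)))
          where
          eq : ∀ b l y → b ℕ.* l ℕ.* y ≡ b ℕ.* (1 ℕ.* (l ℕ.* y))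
          eq = solve-∀
        tournament i done (k ∷ todo) s {S} {B} 0<ui tdone (tk ∷ ttodo) len s≤ good
          with 0ℚ ℚ.<? u (proj₁ k)
        ... | no ≮ = Good-mono
          (ℕ.*-monoʳ-≤ B (ℕ.*-monoˡ-≤ _ (ℕ.^-monoʳ-≤ 2 (ℕ.n≤1+n (length todo)))))
          (Good-⇔ (λ { (s , hi , (hk ∷ ds) , ts) → s , hi , ds , (hk ∷ ts) })
            (λ { (s , hi , ds , (hk ∷ ts)) → s , hi , (hk ∷ ds) , ts })
            (tournament i (k ∷ done) todo s 0<ui ((tk , ℚ.≮⇒≥ ≮) ∷ tdone) ttodo
              (subst (ℕ._≤ s) (ℕ.+-suc _ _) len) s≤ good))
        -- The loser is replaced by the comparison, on which `u` vanishes. Winner and comparison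
        -- imply the loser, so both branches lie in the original relation; having two of them
        -- doubles the constant.
        ... | yes 0<uk = Good-mono (ℕ.≤-reflexive (eq B (2 ℕ.^ length todo) _))
          (Good-∪ split
            (λ { (s , hi , (hik ∷ ds) , ts) → s , hi , ds , (combination-Holds {i} {k} 0<ui 0<uk hi hik ∷ ts) })
            (λ { (s , hk , (hki ∷ ds) , ts) → s , combination-Holds {k} {i} 0<uk 0<ui hk hki , ds , (hk ∷ ts) })
            (tournament i (combination i k ∷ done) todo s 0<ui (T′-combination i k ∷ tdone) ttodo
              (subst (ℕ._≤ s) (ℕ.+-suc _ _) len) s≤ good)
            (tournament k (combination k i ∷ done) todo s 0<uk (T′-combination k i ∷ tdone) ttodo
              (subst (ℕ._≤ s) (ℕ.+-suc _ _) len) s≤ good))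
          where
          eq : ∀ b w y → b ℕ.* (w ℕ.* y) ℕ.+ b ℕ.* (w ℕ.* y) ≡ b ℕ.* ((w ℕ.+ (w ℕ.+ 0)) ℕ.* y)
          eq = solve-∀
          split : ∀ {p q} → S p q × Holds x i p q × Sat x done p q × Sat x (k ∷ todo) p q →
            (S p q × Holds x i p q × Sat x (combination i k ∷ done) p q × Sat x todo p q) ⊎
            (S p q × Holds x k p q × Sat x (combination k i ∷ done) p q × Sat x todo p q)
          split {p} {q} (s , hi , ds , (hk ∷ ts)) with combination-total i k p q
          ... | inj₁ hik = inj₁ (s , hi , (hik ∷ ds) , ts)
          ... | inj₂ hki = inj₂ (s , hk , (hki ∷ ds) , ts)

        -- Looks for a first contestant with `u > 0`. If there is none, no factor arises and the
        -- bound is only weakened, which uses `W ≥ 1`.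
        seek : .{{_ : ℕ.NonZero L}} → ∀ done todo s {S B} → All T′ done → All (T ∘ proj₁) todo →
          length done ℕ.+ length todo ℕ.≤ s → s ℕ.≤ s₀ → Good S B →
          Good (λ p q → S p q × Sat x done p q × Sat x todo p q) (B ℕ.* W ℕ.^ (suc h ℕ.⊓ s))
        seek done [] s {S} {B} tdone [] len s≤ good = Good-mono
          (ℕ.*-monoʳ-≤ B (ℕ.^-monoʳ-≤ W {{W≢0}} (ℕ.⊓-monoˡ-≤ s (ℕ.n≤1+n h))))
          (Good-⇔ (λ (s , ds) → s , ds , []) (λ { (s , ds , []) → s , ds })
            (rest done s tdone (ℕ.≤-trans (ℕ.m≤m+n _ _) len) s≤ good))
          where
          W≢0 : ℕ.NonZero W
          W≢0 = ℕ.m*n≢0 (2 ℕ.^ s₀) L {{ℕ.m^n≢0 2 s₀}}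
        seek done (k ∷ todo) s {S} {B} tdone (tk ∷ ttodo) len s≤ good
          with 0ℚ ℚ.<? u (proj₁ k) | subst (ℕ._≤ s) (ℕ.+-suc _ _) len
        ... | no ≮ | len′ = Good-⇔
          (λ { (s , (hk ∷ ds) , ts) → s , ds , (hk ∷ ts) }) (λ { (s , ds , (hk ∷ ts)) → s , (hk ∷ ds) , ts })
          (seek (k ∷ done) todo s ((tk , ℚ.≮⇒≥ ≮) ∷ tdone) ttodo len′ s≤ good)
        -- The contestant leaves the list, so `s` drops to `s′` and the exponent `suc h ⊓ suc s′`
        -- supplies one more factor `W`, which absorbs `L` and the at most `2 ^ s₀` branches.
        ... | yes 0<uk | ℕ.s≤s {n = s′} len′ = Good-mono
          (ℕ.*-monoʳ-≤ B (ℕ.≤-trans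
            (ℕ.≤-reflexive (sym (ℕ.*-assoc (2 ℕ.^ length todo) L _)))
            (ℕ.*-monoˡ-≤ (W ℕ.^ (h ℕ.⊓ s′)) (ℕ.*-monoˡ-≤ L (ℕ.^-monoʳ-≤ 2
              (ℕ.≤-trans (ℕ.m≤n+m _ (length done)) (ℕ.≤-trans len′ (ℕ.<⇒≤ s≤))))))))
          (Good-⇔ (λ (s , hk , ds , ts) → s , ds , (hk ∷ ts)) (λ { (s , ds , (hk ∷ ts)) → s , hk , ds , ts })
            (tournament k done todo s′ 0<uk tdone ttodo len′ (ℕ.<⇒≤ s≤) good))

        Eliminable-halfStep : .{{_ : ℕ.NonZero L}} → Eliminable x T (suc h)
        Eliminable-halfStep cs s ts len s≤ good =
          Good-⇔ (λ { (s , [] , sat) → s , sat }) (λ (s , sat) → s , [] , sat) (seek [] cs s [] ts len s≤ good)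

    Eliminable-drop : ∀ {d h} (x : Fin n → Fin (suc d) → ℚ) →
      Eliminable (λ p → x p ∘ suc) (λ _ → ⊤) h → Eliminable x (λ a → a zero ≡ 0ℚ) h
    Eliminable-drop x rest cs s ts len s≤ good =
      Good-⇔ (λ (s , sat) → s , fwd ts sat) (λ (s , sat) → s , bwd ts sat)
        (rest (map tailᶜ cs) s (All.universal (λ _ → tt) _)
          (subst (ℕ._≤ s) (sym (List.length-map tailᶜ cs)) len) s≤ good)
      where
      tailᶜ : ∀ {d} → Constraint Q (suc d) → Constraint Q d
      tailᶜ (a , c) = a ∘ suc , c
      dot-tail : ∀ {d} {a : Fin (suc d) → ℚ} (y : Fin (suc d) → ℚ) → a zero ≡ 0ℚ →
        dot a y ≡ dot (a ∘ suc) (y ∘ suc)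
      dot-tail {a = a} y a₀≡0 rewrite a₀≡0 | ℚ.*-zeroˡ (y zero) = ℚ.+-identityˡ (dot (a ∘ suc) (y ∘ suc))
      fwd : ∀ {cs p q} → All (λ k → proj₁ k zero ≡ 0ℚ) cs →
        Sat (λ p → x p ∘ suc) (map tailᶜ cs) p q → Sat x cs p q
      fwd []       []        = []
      fwd {p = p} {q} (_∷_ {x = k} t ts) (h ∷ hs) =
        subst (ℚ._≤ proj₂ k q) (sym (dot-tail {a = proj₁ k} (x p) t)) h ∷ fwd ts hs
      bwd : ∀ {cs p q} → All (λ k → proj₁ k zero ≡ 0ℚ) cs →
        Sat x cs p q → Sat (λ p → x p ∘ suc) (map tailᶜ cs) p q
      bwd []       []        = []
      bwd {p = p} {q} (_∷_ {x = k} t ts) (h ∷ hs) =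
        subst (ℚ._≤ proj₂ k q) (dot-tail {a = proj₁ k} (x p) t) h ∷ bwd ts hs

    -- Two half-steps per coordinate: the first leaves leading coefficients `≤ 0`, the second, run
    -- on their negatives, leaves `0`, and the coordinate drops out. In dimension zero every
    -- constraint depends on `q` alone.
    eliminate : .{{_ : ℕ.NonZero L}} → ∀ {d} (x : Fin n → Fin d → ℚ) → Eliminable x (λ _ → ⊤) (d ℕ.* 2)
    eliminate {zero} x cs s {B = B} _ _ _ good =
      Good-mono (ℕ.≤-reflexive (sym (ℕ.*-identityʳ B)))
        (Good-∩ʳ (λ q → All.all? (λ (a , c) → 0ℚ ℚ.≤? c q) cs) good)
    eliminate {suc d} x =
      HalfStep.Eliminable-halfStep x (λ a → a zero) (λ _ _ → tt)
        (λ (a , _) (b , _) → eq⁺ (a zero) (b zero))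
        (HalfStep.Eliminable-halfStep x (λ a → ℚ.- a zero)
          (λ (a , _) (b , _) → tt , ℚ.≤-reflexive (eq⁻ (a zero) (b zero)))
          (λ (a , _) (b , _) → cong ℚ.-_ (eq⁻ (a zero) (b zero)))
          λ cs s ts → Eliminable-drop {h = d ℕ.* 2} x (eliminate (λ p → x p ∘ suc)) cs s
            (All.map (λ ((_ , ≤0) , -≤0) → ℚ.≤-antisym ≤0 (neg≤0⇒0≤ -≤0)) ts))
      where
      eq⁺ : ∀ a b → a ℚ.* b ℚ.- b ℚ.* a ≡ 0ℚ
      eq⁺ = solve 2 (λ a b → a :* b :- b :* a := con 0ℚ) refl
      eq⁻ : ∀ a b → (ℚ.- a) ℚ.* b ℚ.- (ℚ.- b) ℚ.* a ≡ 0ℚ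
      eq⁻ = solve 2 (λ a b → (:- a) :* b :- (:- b) :* a := con 0ℚ) refl
      neg≤0⇒0≤ : ∀ {a} → ℚ.- a ℚ.≤ 0ℚ → 0ℚ ℚ.≤ a
      neg≤0⇒0≤ {a} -a≤0 = subst (0ℚ ℚ.≤_) (neg-neg a) (ℚ.neg-antimono-≤ -a≤0)
        where
        neg-neg : ∀ a → ℚ.- (ℚ.- a) ≡ a
        neg-neg = solve 1 (λ a → :- (:- a) := a) refl

-- Estimates for the logarithm

toℚ : ℕ → ℚ
toℚ n = + n ℚ./ 1

toℚ-mono-≤ : ∀ {m n} → m ℕ.≤ n → toℚ m ℚ.≤ toℚ n
toℚ-mono-≤ {m} {n} m≤n = ℚ.toℚᵘ-cancel-≤ (begin
    ℚ.toℚᵘ (toℚ m)  ≃⟨ toℚᵘ-/ m 0 ⟩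
    mkℚᵘ (+ m) 0    ≤⟨ ℚᵘ.*≤* (ℤ.*-monoʳ-≤-nonNeg (+ 1) (ℤ.+≤+ m≤n)) ⟩
    mkℚᵘ (+ n) 0    ≃⟨ toℚᵘ-/ n 0 ⟨
    ℚ.toℚᵘ (toℚ n)  ∎)
  where open ℚᵘ.≤-Reasoning

toℚ-* : ∀ m n → toℚ (m ℕ.* n) ≡ toℚ m ℚ.* toℚ n
toℚ-* m n = ℚ.toℚᵘ-injective (begin-equality
    ℚ.toℚᵘ (toℚ (m ℕ.* n))                    ≃⟨ toℚᵘ-/ (m ℕ.* n) 0 ⟩
    mkℚᵘ (+ (m ℕ.* n)) 0                      ≃⟨ ℚᵘ.*≡* (cong (ℤ._* + 1) (ℤ.pos-* m n)) ⟩
    mkℚᵘ (+ m) 0 ℚᵘ.* mkℚᵘ (+ n) 0            ≃⟨ ℚᵘ.*-cong (toℚᵘ-/ m 0) (toℚᵘ-/ n 0) ⟨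
    ℚ.toℚᵘ (toℚ m) ℚᵘ.* ℚ.toℚᵘ (toℚ n)        ≃⟨ ℚ.toℚᵘ-homo-* (toℚ m) (toℚ n) ⟨
    ℚ.toℚᵘ (toℚ m ℚ.* toℚ n)                  ∎)
  where open ℚᵘ.≤-Reasoning

toℚ-suc : ∀ n → toℚ (suc n) ≡ toℚ n ℚ.+ 1ℚ
toℚ-suc n = trans (sym (ℚ.*-identityʳ (toℚ (suc n))))
  (trans (suc-* n 1ℚ) (cong (ℚ._+ 1ℚ) (ℚ.*-identityʳ (toℚ n))))

toℚ-nonNeg : ∀ n → ℚ.NonNegative (toℚ n)
toℚ-nonNeg n = ℚ.nonNegative (toℚ-mono-≤ {0} {n} ℕ.z≤n)

harmonic-mono-≤ : ∀ {m n} → m ℕ.≤ n → harmonic m ℚ.≤ harmonic n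
harmonic-mono-≤ m≤n = go (ℕ.≤⇒≤′ m≤n)
  where
  go : ∀ {m n} → m ℕ.≤′ n → harmonic m ℚ.≤ harmonic n
  go ℕ.≤′-refl = ℚ.≤-refl
  go (ℕ.≤′-step {n} m≤n) = ℚ.≤-trans (go m≤n)
    (ℚ.≤-trans (ℚ.≤-reflexive (sym (ℚ.+-identityʳ _))) (ℚ.+-monoʳ-≤ (harmonic n) (inv-nonNeg n)))

-- The `j` additional terms are each at least `1 / (2 j)`.
harmonic-double : ∀ j .{{_ : ℕ.NonZero j}} → harmonic j ℚ.+ ½ ℚ.≤ harmonic (j ℕ.+ j)
harmonic-double (suc p) = subst (λ y → harmonic (suc p) ℚ.+ y ℚ.≤ harmonic (suc p ℕ.+ suc p)) (*-inv p 1)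
  (harmonic-lower (suc p) (suc p) (ℕ.pred (suc p ℕ.* 2)) (ℕ.≤-reflexive (eq (suc p))))
  where
  eq : ∀ j → j ℕ.+ j ≡ j ℕ.* 2
  eq = solve-∀

harmonic-2^ : ∀ l → ½ ℚ.* toℚ l ℚ.+ 1ℚ ℚ.≤ harmonic (2 ℕ.^ l)
harmonic-2^ zero    = ℚ.≤-refl
harmonic-2^ (suc l) = begin
    ½ ℚ.* toℚ (suc l) ℚ.+ 1ℚ          ≡⟨ cong (λ y → ½ ℚ.* y ℚ.+ 1ℚ) (toℚ-suc l) ⟩
    ½ ℚ.* (toℚ l ℚ.+ 1ℚ) ℚ.+ 1ℚ       ≡⟨ eq (toℚ l) ⟩
    (½ ℚ.* toℚ l ℚ.+ 1ℚ) ℚ.+ ½        ≤⟨ ℚ.+-monoˡ-≤ ½ (harmonic-2^ l) ⟩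
    harmonic (2 ℕ.^ l) ℚ.+ ½          ≤⟨ harmonic-double (2 ℕ.^ l) {{ℕ.m^n≢0 2 l}} ⟩
    harmonic (2 ℕ.^ l ℕ.+ 2 ℕ.^ l)    ≡⟨ cong (λ k → harmonic (2 ℕ.^ l ℕ.+ k)) (ℕ.+-identityʳ (2 ℕ.^ l)) ⟨
    harmonic (2 ℕ.^ suc l)            ∎
  where
  open ℚ.≤-Reasoning
  eq : ∀ y → ½ ℚ.* (y ℚ.+ 1ℚ) ℚ.+ 1ℚ ≡ (½ ℚ.* y ℚ.+ 1ℚ) ℚ.+ ½
  eq = solve 1 (λ y → con ½ :* (y :+ con 1ℚ) :+ con 1ℚ := (con ½ :* y :+ con 1ℚ) :+ con ½) refl

lnSeq-mono-≤ : ∀ p {k m} → k ℕ.≤ m → lnSeq (suc p) k ℚ.≤ seq (ln (suc p)) m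
lnSeq-mono-≤ p = Monotone.lower (lnSeq (suc p)) (lnSeq-increasing p) (lnSeq-decreasing p)

-- The sequence increases, so its initial term, `harmonic (suc p) - 1`, bounds all others from
-- below.
ln-2^ : ∀ l p m → 2 ℕ.^ l ℕ.≤ suc p → ½ ℚ.* toℚ l ℚ.≤ seq (ln (suc p)) m
ln-2^ l p m 2^l≤ = begin
    ½ ℚ.* toℚ l                          ≡⟨ eq (½ ℚ.* toℚ l) ⟩
    (½ ℚ.* toℚ l ℚ.+ 1ℚ) ℚ.- 1ℚ          ≤⟨ ℚ.+-monoˡ-≤ (ℚ.- 1ℚ) (ℚ.≤-trans (harmonic-2^ l)
                                              (harmonic-mono-≤ (ℕ.≤-trans 2^l≤ (ℕ.m≤m*n (suc p) 1)))) ⟩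
    lnSeq (suc p) 0                      ≤⟨ lnSeq-mono-≤ p (ℕ.z≤n {m}) ⟩
    seq (ln (suc p)) m                   ∎
  where
  open ℚ.≤-Reasoning
  eq : ∀ y → y ≡ (y ℚ.+ 1ℚ) ℚ.- 1ℚ
  eq = solve 1 (λ y → y := (y :+ con 1ℚ) :- con 1ℚ) refl

-- The fourth term of lnSeq 3 is H₁₂ − H₄ = 1.0198…, the first one to exceed 1.
1≤ln : ∀ {n m} → 3 ℕ.≤ n → 3 ℕ.≤ m → 1ℚ ℚ.≤ seq (ln n) m
1≤ln {suc p} {m} 3≤n 3≤m = begin
    1ℚ                                   ≤⟨ ℚ.≤ᵇ⇒≤ _ ⟩
    lnSeq 3 3                            ≤⟨ ℚ.+-monoˡ-≤ (ℚ.- harmonic 4)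
                                              (harmonic-mono-≤ (ℕ.*-monoˡ-≤ 4 3≤n)) ⟩
    lnSeq (suc p) 3                      ≤⟨ lnSeq-mono-≤ p 3≤m ⟩
    seq (ln (suc p)) m                   ∎
  where open ℚ.≤-Reasoning

dyadic : ∀ n → ∃ λ l → suc n ℕ.< 2 ℕ.^ suc l × 2 ℕ.^ l ℕ.≤ suc n
dyadic zero = 0 , ℕ.≤-refl , ℕ.≤-refl
dyadic (suc n) with dyadic n
... | l , n<2^ , 2^l≤n with suc (suc n) ℕ.<? 2 ℕ.^ suc l
...   | yes < = l , < , ℕ.m≤n⇒m≤1+n 2^l≤n
...   | no ≮  = suc l ,
  ℕ.<-≤-trans (ℕ.s≤s n<2^) (ℕ.≤-trans (ℕ.+-monoˡ-≤ (2 ℕ.^ suc l) (ℕ.m^n>0 2 (suc l)))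
    (ℕ.+-monoʳ-≤ (2 ℕ.^ suc l) (ℕ.m≤m+n (2 ℕ.^ suc l) 0))) ,
  ℕ.≮⇒≥ ≮

-- `suc l` will be the number of halvings. The factor 3 is 2 + 1: `½ * l` is at most each term of
-- `ln n`, and the extra 1 is at most each term from index 3 on.
log₂-ln : ∀ {n} → 3 ℕ.≤ n → ∃ λ l → n ℕ.< 2 ℕ.^ suc l ×
  (∀ {m} → 3 ℕ.≤ m → toℚ (suc l) ℚ.≤ toℚ 3 ℚ.* seq (ln n) m)
log₂-ln {suc p} 3≤n with dyadic p
... | l , n<2^ , 2^l≤n = l , n<2^ , λ {m} 3≤m → begin
    toℚ (suc l)                            ≡⟨ toℚ-suc l ⟩
    toℚ l ℚ.+ 1ℚ                           ≡⟨ eq₁ (toℚ l) ⟩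
    (½ ℚ.* toℚ l ℚ.+ ½ ℚ.* toℚ l) ℚ.+ 1ℚ   ≤⟨ ℚ.+-mono-≤ (ℚ.+-mono-≤ (ln-2^ l p m 2^l≤n) (ln-2^ l p m 2^l≤n))
                                                         (1≤ln 3≤n 3≤m) ⟩
    (seq (ln (suc p)) m ℚ.+ seq (ln (suc p)) m) ℚ.+ seq (ln (suc p)) m
                                           ≡⟨ eq₂ (seq (ln (suc p)) m) ⟩
    toℚ 3 ℚ.* seq (ln (suc p)) m           ∎
  where
  open ℚ.≤-Reasoning
  eq₁ : ∀ y → y ℚ.+ 1ℚ ≡ (½ ℚ.* y ℚ.+ ½ ℚ.* y) ℚ.+ 1ℚ
  eq₁ = solve 1 (λ y → y :+ con 1ℚ := (con ½ :* y :+ con ½ :* y) :+ con 1ℚ) refl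
  eq₂ : ∀ y → (y ℚ.+ y) ℚ.+ y ≡ toℚ 3 ℚ.* y
  eq₂ = solve 1 (λ y → (y :+ y) :+ y := con (toℚ 3) :* y) refl

1≤seq-^ : ∀ x {m} k → 1ℚ ℚ.≤ seq x m → 1ℚ ℚ.≤ seq (x ^ k) m
1≤seq-^ x     zero    1≤x = ℚ.≤-refl
1≤seq-^ x {m} (suc k) 1≤x = begin
    1ℚ                          ≤⟨ 1≤x ⟩
    seq x m                     ≡⟨ ℚ.*-identityʳ (seq x m) ⟨
    seq x m ℚ.* 1ℚ              ≤⟨ ℚ.*-monoˡ-≤-nonNeg (seq x m)
                                     {{ℚ.nonNegative (ℚ.≤-trans (ℚ.≤ᵇ⇒≤ _) 1≤x)}} (1≤seq-^ x k 1≤x) ⟩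
    seq x m ℚ.* seq (x ^ k) m   ∎
  where open ℚ.≤-Reasoning

-- The surplus powers of `x`, from exponent `e` up to `k`, only help because `1 ≤ x`.
toℚ-^-≤ : ∀ x {m} L a {e k} → e ℕ.≤ k → 1ℚ ℚ.≤ seq x m → toℚ L ℚ.≤ toℚ a ℚ.* seq x m →
  toℚ (L ℕ.^ e) ℚ.≤ toℚ (a ℕ.^ e) ℚ.* seq (x ^ k) m
toℚ-^-≤ x {m} L a {k = k} ℕ.z≤n 1≤x _ =
  ℚ.≤-trans (1≤seq-^ x k 1≤x) (ℚ.≤-reflexive (sym (ℚ.*-identityˡ (seq (x ^ k) m))))
toℚ-^-≤ x {m} L a {suc e} {suc k} (ℕ.s≤s e≤k) 1≤x L≤ = begin
    toℚ (L ℕ.* L ℕ.^ e)                  ≡⟨ toℚ-* L (L ℕ.^ e) ⟩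
    toℚ L ℚ.* toℚ (L ℕ.^ e)              ≤⟨ ℚ.*-monoˡ-≤-nonNeg (toℚ L) {{toℚ-nonNeg L}} (toℚ-^-≤ x L a e≤k 1≤x L≤) ⟩
    toℚ L ℚ.* (α ℚ.* Y)                  ≤⟨ ℚ.*-monoʳ-≤-nonNeg (α ℚ.* Y) {{ℚ.nonNegative
                                              (ℚ.≤-trans (toℚ-mono-≤ {0} {L ℕ.^ e} ℕ.z≤n) (toℚ-^-≤ x L a e≤k 1≤x L≤))}} L≤ ⟩
    (toℚ a ℚ.* seq x m) ℚ.* (α ℚ.* Y)    ≡⟨ eq (toℚ a) (seq x m) α Y ⟩
    (toℚ a ℚ.* α) ℚ.* (seq x m ℚ.* Y)    ≡⟨ cong (ℚ._* (seq x m ℚ.* Y)) (toℚ-* a (a ℕ.^ e)) ⟨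
    toℚ (a ℕ.* a ℕ.^ e) ℚ.* (seq x m ℚ.* Y)  ∎
  where
  open ℚ.≤-Reasoning
  α Y : ℚ
  α = toℚ (a ℕ.^ e)
  Y = seq (x ^ k) m
  eq : ∀ a x α Y → (a ℚ.* x) ℚ.* (α ℚ.* Y) ≡ (a ℚ.* α) ℚ.* (x ℚ.* Y)
  eq = solve 4 (λ a x α Y → (a :* x) :* (α :* Y) := (a :* α) :* (x :* Y)) refl

^-distribʳ-* : ∀ k a b → (a ℕ.* b) ℕ.^ k ≡ a ℕ.^ k ℕ.* b ℕ.^ k
^-distribʳ-* zero    a b = refl
^-distribʳ-* (suc k) a b =
  trans (cong (a ℕ.* b ℕ.*_) (^-distribʳ-* k a b)) (interchange a b (a ℕ.^ k) (b ℕ.^ k))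
  where
  interchange : ∀ a b y z → a ℕ.* b ℕ.* (y ℕ.* z) ≡ a ℕ.* y ℕ.* (b ℕ.* z)
  interchange = solve-∀

-- The 2 comes from the `n + n` vertices, `(2 ^ s) ^ s` from the branching, `3 ^ s` from passing
-- from binary to natural logarithms.
constant : ℕ → ℕ
constant s = 2 ℕ.* (2 ℕ.^ s) ℕ.^ s ℕ.* 3 ℕ.^ s

-- The exponent `d * 2 ⊓ s` is bounded in two ways: by `s`, to keep the constant independent of `d`,
-- and by `2 * d`, for the power of the logarithm.
ℕ-bound-≤ : ∀ {s t d n m L} → 1ℚ ℚ.≤ seq (ln n) m → toℚ L ℚ.≤ toℚ 3 ℚ.* seq (ln n) m →
  toℚ (t ℕ.* (2 ℕ.^ s ℕ.* L) ℕ.^ (d ℕ.* 2 ℕ.⊓ s) ℕ.* (n ℕ.+ n)) ℚ.≤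
  seq (fromℕ (constant s) * fromℕ t * fromℕ n * ln n ^ (2 ℕ.* d)) m
ℕ-bound-≤ {s} {t} {d} {n} {m} {L} 1≤ L≤ = begin
    toℚ (t ℕ.* (2 ℕ.^ s ℕ.* L) ℕ.^ e ℕ.* (n ℕ.+ n))
      ≤⟨ toℚ-mono-≤ nat-≤ ⟩
    toℚ (K ℕ.* L ℕ.^ e)
      ≡⟨ toℚ-* K (L ℕ.^ e) ⟩
    toℚ K ℚ.* toℚ (L ℕ.^ e)
      ≤⟨ ℚ.*-monoˡ-≤-nonNeg (toℚ K) {{toℚ-nonNeg K}} (toℚ-^-≤ (ln n) L 3 e≤2d 1≤ L≤) ⟩
    toℚ K ℚ.* (toℚ (3 ℕ.^ e) ℚ.* Y)
      ≤⟨ ℚ.*-monoˡ-≤-nonNeg (toℚ K) {{toℚ-nonNeg K}} (ℚ.*-monoʳ-≤-nonNeg Y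
           {{ℚ.nonNegative (ℚ.≤-trans (ℚ.≤ᵇ⇒≤ _) (1≤seq-^ (ln n) (2 ℕ.* d) 1≤))}}
           (toℚ-mono-≤ (ℕ.^-monoʳ-≤ 3 (ℕ.m⊓n≤n (d ℕ.* 2) s)))) ⟩
    toℚ K ℚ.* (toℚ (3 ℕ.^ s) ℚ.* Y)
      ≡⟨ ℚ.*-assoc (toℚ K) (toℚ (3 ℕ.^ s)) Y ⟨
    toℚ K ℚ.* toℚ (3 ℕ.^ s) ℚ.* Y
      ≡⟨ cong (ℚ._* Y) (trans (sym (toℚ-* K (3 ℕ.^ s))) (trans (cong toℚ (eq₂ ((2 ℕ.^ s) ℕ.^ s) t n (3 ℕ.^ s)))
           (trans (toℚ-* (constant s ℕ.* t) n) (cong (ℚ._* toℚ n) (toℚ-* (constant s) t))))) ⟩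
    toℚ (constant s) ℚ.* toℚ t ℚ.* toℚ n ℚ.* Y ∎
  where
  open ℚ.≤-Reasoning
  e K : ℕ
  e = d ℕ.* 2 ℕ.⊓ s
  K = 2 ℕ.* (2 ℕ.^ s) ℕ.^ s ℕ.* t ℕ.* n
  Y : ℚ
  Y = seq (ln n ^ (2 ℕ.* d)) m
  e≤2d : e ℕ.≤ 2 ℕ.* d
  e≤2d = ℕ.≤-trans (ℕ.m⊓n≤m (d ℕ.* 2) s) (ℕ.≤-reflexive (ℕ.*-comm d 2))
  eq₁ : ∀ t A B n → t ℕ.* (A ℕ.* B) ℕ.* (n ℕ.+ n) ≡ 2 ℕ.* A ℕ.* t ℕ.* n ℕ.* B
  eq₁ = solve-∀
  eq₂ : ∀ A t n T → 2 ℕ.* A ℕ.* t ℕ.* n ℕ.* T ≡ 2 ℕ.* A ℕ.* T ℕ.* t ℕ.* n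
  eq₂ = solve-∀
  nat-≤ : t ℕ.* (2 ℕ.^ s ℕ.* L) ℕ.^ e ℕ.* (n ℕ.+ n) ℕ.≤ K ℕ.* L ℕ.^ e
  nat-≤ = ℕ.≤-trans
    (ℕ.*-monoˡ-≤ (n ℕ.+ n) (ℕ.*-monoʳ-≤ t (ℕ.≤-trans
      (ℕ.≤-reflexive (^-distribʳ-* e (2 ℕ.^ s) L))
      (ℕ.*-monoˡ-≤ (L ℕ.^ e) (ℕ.^-monoʳ-≤ (2 ℕ.^ s) {{ℕ.m^n≢0 2 s}} (ℕ.m⊓n≤n (d ℕ.* 2) s))))))
    (ℕ.≤-reflexive (eq₁ t ((2 ℕ.^ s) ℕ.^ s) (L ℕ.^ e) n))

-- From real to rational constraints

Eventually : (ℕ → Set) → Set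
Eventually A = ∃ λ N → ∀ {m} → N ℕ.≤ m → A m

Eventually-∀ : ∀ {k} {A : Fin k → ℕ → Set} → (∀ i → Eventually (A i)) → Eventually (λ m → ∀ i → A i m)
Eventually-∀ {zero}  ev = 0 , λ _ ()
Eventually-∀ {suc k} ev with ev zero | Eventually-∀ (ev ∘ suc)
... | N , h | M , hs = N ℕ.⊔ M ,
  λ le → Fin.∀-cons (h (ℕ.m⊔n≤o⇒m≤o N M le)) (hs (ℕ.m⊔n≤o⇒n≤o N M le))

-- Allows classical case distinctions at finitely many indices at once while a negation is being
-- proved.
¬¬-∀ : ∀ {k} {A : Fin k → Set} → (∀ i → ¬ ¬ A i) → ¬ ¬ (∀ i → A i)
¬¬-∀ = Fin.sequence (RawMonad.rawApplicative ¬¬-Monad)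

¬¬-Eventually-∀ : ∀ {k} {A : Fin k → ℕ → Set} → (∀ i → ¬ ¬ Eventually (A i)) →
  ¬ ¬ Eventually (λ m → ∀ i → A i m)
¬¬-Eventually-∀ ev = ¬¬-map Eventually-∀ (¬¬-∀ ev)

¬¬-All : {R : Pred A 0ℓ} {xs : List A} → (∀ {x} → x ∈ˡ xs → ¬ ¬ R x) → ¬ ¬ All R xs
¬¬-All {xs = []}     r ¬all = ¬all []
¬¬-All {xs = x ∷ xs} r ¬all = r (here refl) λ rx → ¬¬-All (r ∘ there) λ rxs → ¬all (rx ∷ rxs)

⅛ ¼ : ℚ
⅛ = + 1 ℚ./ 8
¼ = + 1 ℚ./ 4

0<*ε : ∀ r .{{_ : ℚ.Positive r}} {ε} → 0ℚ ℚ.< ε → 0ℚ ℚ.< r ℚ.* ε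
0<*ε r 0<ε = ℚ.≤-<-trans (ℚ.≤-reflexive (sym (ℚ.*-zeroʳ r))) (ℚ.*-monoʳ-<-pos r 0<ε)

-- Compare `z` with `x + ½ ε` at one index `K`, after which `x` and `z` each drift by less than
-- `⅛ ε`. The gap that remains is `½ - ⅛ - ⅛` or `1 - ½ - ⅛ - ⅛` times `ε`, in both cases `¼ ε`.
<-cotrans : ∀ {x y} → x < y → ∀ z → x < z ⊎ z < y
<-cotrans {x} {y} (ε , 0<ε , N , x+ε≤y) z
  with cauchy x (⅛ ℚ.* ε) (0<*ε ⅛ 0<ε) | cauchy z (⅛ ℚ.* ε) (0<*ε ⅛ 0<ε)
... | M₁ , near-x | M₂ , near-z = compare (seq x K ℚ.+ ½ ℚ.* ε ℚ.≤? seq z K)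
  where
  open ℚ.≤-Reasoning
  K : ℕ
  K = N ℕ.⊔ (M₁ ℕ.⊔ M₂)
  N≤ : N ℕ.≤ K
  N≤ = ℕ.m≤m⊔n N _
  M₁≤ : M₁ ℕ.≤ K
  M₁≤ = ℕ.≤-trans (ℕ.m≤m⊔n M₁ M₂) (ℕ.m≤n⊔m N _)
  M₂≤ : M₂ ℕ.≤ K
  M₂≤ = ℕ.≤-trans (ℕ.m≤n⊔m M₁ M₂) (ℕ.m≤n⊔m N _)
  close : ∀ p q {δ} → ℚ.∣ p ℚ.- q ∣ ℚ.< δ → p ℚ.≤ q ℚ.+ δ
  close p q {δ} lt = begin
    p               ≡⟨ eq p q ⟩
    q ℚ.+ (p ℚ.- q) ≤⟨ ℚ.+-monoʳ-≤ q (ℚ.≤-trans (p≤∣p∣ (p ℚ.- q)) (ℚ.<⇒≤ lt)) ⟩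
    q ℚ.+ δ         ∎
    where
    eq : ∀ p q → p ≡ q ℚ.+ (p ℚ.- q)
    eq = solve 2 (λ p q → p := q :+ (p :- q)) refl
    p≤∣p∣ : ∀ p → p ℚ.≤ ℚ.∣ p ∣
    p≤∣p∣ p with ℚ.≤-total 0ℚ p
    ... | inj₁ 0≤p = ℚ.≤-reflexive (sym (ℚ.0≤p⇒∣p∣≡p 0≤p))
    ... | inj₂ p≤0 = ℚ.≤-trans p≤0 (ℚ.0≤∣p∣ p)
  compare : Dec (seq x K ℚ.+ ½ ℚ.* ε ℚ.≤ seq z K) → x < z ⊎ z < y
  compare (yes x+½ε≤z) = inj₁ (¼ ℚ.* ε , 0<*ε ¼ 0<ε , K , λ {m} K≤m → begin
    seq x m ℚ.+ ¼ ℚ.* ε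
      ≤⟨ ℚ.+-monoˡ-≤ (¼ ℚ.* ε) (close (seq x m) (seq x K) (near-x (ℕ.≤-trans M₁≤ K≤m) M₁≤)) ⟩
    seq x K ℚ.+ ⅛ ℚ.* ε ℚ.+ ¼ ℚ.* ε
      ≡⟨ eq₁ (seq x K) ε ⟩
    seq x K ℚ.+ ½ ℚ.* ε ℚ.- ⅛ ℚ.* ε
      ≤⟨ ℚ.+-monoˡ-≤ (ℚ.- (⅛ ℚ.* ε)) (ℚ.≤-trans x+½ε≤z (close (seq z K) (seq z m) (near-z M₂≤ (ℕ.≤-trans M₂≤ K≤m)))) ⟩
    seq z m ℚ.+ ⅛ ℚ.* ε ℚ.- ⅛ ℚ.* ε
      ≡⟨ eq₂ (seq z m) (⅛ ℚ.* ε) ⟩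
    seq z m ∎)
    where
    eq₁ : ∀ x ε → x ℚ.+ ⅛ ℚ.* ε ℚ.+ ¼ ℚ.* ε ≡ x ℚ.+ ½ ℚ.* ε ℚ.- ⅛ ℚ.* ε
    eq₁ = solve 2 (λ x ε → x :+ con ⅛ :* ε :+ con ¼ :* ε := x :+ con ½ :* ε :- con ⅛ :* ε) refl
    eq₂ : ∀ z δ → z ℚ.+ δ ℚ.- δ ≡ z
    eq₂ = solve 2 (λ z δ → z :+ δ :- δ := z) refl
  compare (no x+½ε≰z) = inj₂ (¼ ℚ.* ε , 0<*ε ¼ 0<ε , K , λ {m} K≤m → begin
    seq z m ℚ.+ ¼ ℚ.* ε
      ≤⟨ ℚ.+-monoˡ-≤ (¼ ℚ.* ε) (close (seq z m) (seq z K) (near-z (ℕ.≤-trans M₂≤ K≤m) M₂≤)) ⟩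
    seq z K ℚ.+ ⅛ ℚ.* ε ℚ.+ ¼ ℚ.* ε
      ≤⟨ ℚ.+-monoˡ-≤ (¼ ℚ.* ε) (ℚ.+-monoˡ-≤ (⅛ ℚ.* ε) (ℚ.<⇒≤ (ℚ.≰⇒> x+½ε≰z))) ⟩
    seq x K ℚ.+ ½ ℚ.* ε ℚ.+ ⅛ ℚ.* ε ℚ.+ ¼ ℚ.* ε
      ≤⟨ ℚ.+-monoˡ-≤ (¼ ℚ.* ε) (ℚ.+-monoˡ-≤ (⅛ ℚ.* ε) (ℚ.+-monoˡ-≤ (½ ℚ.* ε)
           (close (seq x K) (seq x m) (near-x M₁≤ (ℕ.≤-trans M₁≤ K≤m))))) ⟩
    seq x m ℚ.+ ⅛ ℚ.* ε ℚ.+ ½ ℚ.* ε ℚ.+ ⅛ ℚ.* ε ℚ.+ ¼ ℚ.* ε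
      ≡⟨ eq (seq x m) ε ⟩
    seq x m ℚ.+ ε
      ≤⟨ x+ε≤y (ℕ.≤-trans N≤ K≤m) ⟩
    seq y m ∎)
    where
    eq : ∀ x ε → x ℚ.+ ⅛ ℚ.* ε ℚ.+ ½ ℚ.* ε ℚ.+ ⅛ ℚ.* ε ℚ.+ ¼ ℚ.* ε ≡ x ℚ.+ ε
    eq = solve 2 (λ x ε → x :+ con ⅛ :* ε :+ con ½ :* ε :+ con ⅛ :* ε :+ con ¼ :* ε := x :+ ε) refl

-- `¬ (y ≤ b)` is `¬ ¬ (b < y)`, and cotransitivity at `x` leaves only `x < y`. The offset `b`
-- disappears.
≤-separates : ∀ {b x y} → x ≤ b → ¬ (y ≤ b) → ¬ ¬ (x < y)
≤-separates {b} {x} {y} x≤b y≰b x≮y = y≰b λ b<y → Sum.[ x≤b , x≮y ]′ (<-cotrans {b} {y} b<y x)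

<-separates : ∀ {b x y} → x < b → ¬ (y < b) → ¬ ¬ (x < y)
<-separates {b} {x} {y} x<b y≮b x≮y = Sum.[ x≮y , y≮b ]′ (<-cotrans {x} {b} x<b y)

<-eventually : ∀ {x y} → x < y → Eventually (λ m → seq x m ℚ.< seq y m)
<-eventually {x} (ε , 0<ε , N , x+ε≤y) = N , λ {m} N≤m → ℚ.<-≤-trans
  (ℚ.≤-<-trans (ℚ.≤-reflexive (sym (ℚ.+-identityʳ (seq x m)))) (ℚ.+-monoʳ-< (seq x m) 0<ε)) (x+ε≤y N≤m)

_at_ : ∀ {d} → Point d → ℕ → Fin d → ℚ
(x at m) j = seq (x j) m

seq-⟨⟩ : ∀ {d} (a x : Point d) m → seq ⟨ a , x ⟩ m ≡ dot (a at m) (x at m)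
seq-⟨⟩ {zero}  a x m = refl
seq-⟨⟩ {suc d} a x m = cong (λ y → seq (a zero) m ℚ.* seq (x zero) m ℚ.+ y) (seq-⟨⟩ (a ∘ suc) (x ∘ suc) m)

dot-difference : ∀ {d} (a x v : Fin d → ℚ) → dot a (λ j → x j ℚ.- v j) ≡ dot a x ℚ.- dot a v
dot-difference {zero}  a x v = refl
dot-difference {suc d} a x v =
  trans (cong (λ y → a zero ℚ.* (x zero ℚ.- v zero) ℚ.+ y) (dot-difference (a ∘ suc) (x ∘ suc) (v ∘ suc)))
    (step (a zero) (x zero) (v zero) (dot (a ∘ suc) (x ∘ suc)) (dot (a ∘ suc) (v ∘ suc)))
  where
  step : ∀ a x v α β → a ℚ.* (x ℚ.- v) ℚ.+ (α ℚ.- β) ≡ (a ℚ.* x ℚ.+ α) ℚ.- (a ℚ.* v ℚ.+ β)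
  step = solve 5 (λ a x v α β → a :* (x :- v) :+ (α :- β) := (a :* x :+ α) :- (a :* v :+ β)) refl

normal : ∀ {d} {S : Region d} → IsHalfSpace S → Point d
normal = proj₁

-- The shift by `v` subtracts the same number from the values at both points, so a single functional
-- orders the points for all translates of `S`.
translate-separates : ∀ {d} {S : Region d} (hs : IsHalfSpace S) (v x y : Point d) →
  translate v S x → ¬ translate v S y →
  ¬ ¬ Eventually (λ m → dot (normal hs at m) (x at m) ℚ.< dot (normal hs at m) (y at m))
translate-separates {d} {S} (a , b , _ , cases) v x y x∈ y∉ = ¬¬-map (λ fx<fy → eventually (<-eventually {f x} {f y} fx<fy)) (order cases)
  where
  f : Point d → ℝ
  f z = ⟨ a , zipWith _-_ z v ⟩
  order : S ≐ (λ x → ⟨ a , x ⟩ ≤ b) ⊎ S ≐ (λ x → ⟨ a , x ⟩ < b) → ¬ ¬ (f x < f y)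
  order (inj₁ (S⊆ , ⊆S)) = ≤-separates {b} {f x} {f y} (S⊆ x∈) (y∉ ∘ ⊆S)
  order (inj₂ (S⊆ , ⊆S)) = <-separates {b} {f x} {f y} (S⊆ x∈) (y∉ ∘ ⊆S)
  seq-f : ∀ z m → seq (f z) m ≡ dot (a at m) (z at m) ℚ.- dot (a at m) (v at m)
  seq-f z m = trans (seq-⟨⟩ a (zipWith _-_ z v) m) (dot-difference (a at m) (z at m) (v at m))
  cancel : ∀ p q r → p ℚ.- r ℚ.< q ℚ.- r → p ℚ.< q
  cancel p q r lt = subst₂ ℚ._<_ (eq p r) (eq q r) (ℚ.+-monoˡ-< r lt)
    where
    eq : ∀ p r → p ℚ.- r ℚ.+ r ≡ p
    eq = solve 2 (λ p r → p :- r :+ r := p) refl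
  eventually : Eventually (λ m → seq (f x) m ℚ.< seq (f y) m) →
    Eventually (λ m → dot (a at m) (x at m) ℚ.< dot (a at m) (y at m))
  eventually (N , lt) = N , λ {m} N≤m →
    cancel (dot (a at m) (x at m)) (dot (a at m) (y at m)) (dot (a at m) (v at m))
      (subst₂ ℚ._<_ (seq-f x m) (seq-f y m) (lt N≤m))

-- Thresholds for finitely many rational values.

lower-bound : ∀ {n} (v : Fin n → ℚ) → ∃ λ lo → ∀ p → lo ℚ.< v p
lower-bound {zero}  v = 0ℚ , λ ()
lower-bound {suc n} v with lower-bound (v ∘ suc)
... | lo , lo< = lo ℚ.⊓ (v zero ℚ.- 1ℚ) , Fin.∀-cons
  (ℚ.≤-<-trans (ℚ.p⊓q≤q lo (v zero ℚ.- 1ℚ))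
    (ℚ.<-≤-trans (ℚ.+-monoʳ-< (v zero) (ℚ.negative⁻¹ (ℚ.- 1ℚ))) (ℚ.≤-reflexive (ℚ.+-identityʳ (v zero)))))
  (λ p → ℚ.≤-<-trans (ℚ.p⊓q≤p lo (v zero ℚ.- 1ℚ)) (lo< p))

-- `lo` is the default when `T` is empty. The last component is leastness in the strict form that
-- `threshold` applies to values outside `T`.
maximum : ∀ {n} (v : Fin n → ℚ) {T : Pred (Fin n) 0ℓ} → Decidable T → ∀ lo →
  ∃ λ c → (∀ p → T p → v p ℚ.≤ c) × (∀ w → lo ℚ.< w → (∀ p → T p → v p ℚ.< w) → c ℚ.< w)
maximum {zero}  v T? lo = lo , (λ ()) , λ _ lo<w _ → lo<w
maximum {suc n} v T? lo with maximum (v ∘ suc) (λ p → T? (suc p)) lo | T? zero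
... | c , ≤c , c< | no ¬T₀ = c , Fin.∀-cons (λ T₀ → contradiction T₀ ¬T₀) ≤c ,
  λ w lo<w h → c< w lo<w (h ∘ suc)
... | c , ≤c , c< | yes T₀ = c ℚ.⊔ v zero ,
  Fin.∀-cons (λ _ → ℚ.p≤q⊔p c (v zero)) (λ p Tp → ℚ.≤-trans (≤c p Tp) (ℚ.p≤p⊔q c (v zero))) ,
  λ w lo<w h → ⊔-lub-< (c< w lo<w (h ∘ suc)) (h zero T₀)
  where
  ⊔-lub-< : ∀ {p q w} → p ℚ.< w → q ℚ.< w → p ℚ.⊔ q ℚ.< w
  ⊔-lub-< {p} {q} {w} p<w q<w with ℚ.≤-total p q
  ... | inj₁ p≤q = subst (ℚ._< w) (sym (ℚ.p≤q⇒p⊔q≡q p≤q)) q<w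
  ... | inj₂ q≤p = subst (ℚ._< w) (sym (ℚ.p≥q⇒p⊔q≡p q≤p)) p<w

-- Take the greatest value on `T`. If `T` is empty, `c` lies strictly below every value, so that
-- `v p ≤ c` never holds.
threshold : ∀ {n} (v : Fin n → ℚ) {T : Pred (Fin n) 0ℓ} → Decidable T →
  (∀ p p′ → T p → ¬ T p′ → v p ℚ.< v p′) → ∃ λ c → ∀ p → (T p → v p ℚ.≤ c) × (v p ℚ.≤ c → T p)
threshold v {T} T? separated with lower-bound v
... | lo , lo< with maximum v T? lo
...   | c , ≤c , c< = c , λ p → ≤c p , below p
  where
  below : ∀ p → v p ℚ.≤ c → T p
  below p v≤c with T? p
  ... | yes Tp = Tp
  ... | no ¬Tp = contradiction
    (ℚ.<-≤-trans (c< (v p) (lo< p) (λ p′ Tp′ → separated p′ p Tp′ ¬Tp)) v≤c) (ℚ.<-irrefl refl)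

-- Edge sets of bipartite graphs

module _ {A B : Set} {R : A → B → Set} where

  Orients : (A ⊎ B) × (A ⊎ B) → A × B → Set
  Orients e (a , b) = e ≡ (inj₁ a , inj₂ b) ⊎ e ≡ (inj₂ b , inj₁ a)

  Same : (A ⊎ B) × (A ⊎ B) → (A ⊎ B) × (A ⊎ B) → Set
  Same (u , v) (u′ , v′) = (u ≡ u′ × v ≡ v′) ⊎ (u ≡ v′ × v ≡ u′)

  Orients-Same : ∀ {e e′ ab} → Orients e ab → Orients e′ ab → Same e e′
  Orients-Same (inj₁ refl) (inj₁ refl) = inj₁ (refl , refl)
  Orients-Same (inj₁ refl) (inj₂ refl) = inj₂ (refl , refl)
  Orients-Same (inj₂ refl) (inj₁ refl) = inj₂ (refl , refl)
  Orients-Same (inj₂ refl) (inj₂ refl) = inj₁ (refl , refl)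

  -- Edges that orient to the same pair agree up to reversal, which `DistinctEdges` excludes.
  Orients-≢ : ∀ {e ab es es′} → Orients e ab → All (λ e′ → ¬ Same e e′) es → Pointwise Orients es es′ →
    All (λ ab′ → ¬ (ab ≡ ab′)) es′
  Orients-≢ o []       []        = []
  Orients-≢ {es′ = ab′ ∷ _} o (d ∷ ds) (o′ ∷ os) =
    (λ { refl → d (Orients-Same o o′) }) ∷ Orients-≢ o ds os

  orientEdge : ∀ e → uncurry (Graph._~_ (bipartite A B R)) e → ∃ λ ab → Orients e ab × uncurry R ab
  orientEdge (inj₁ a , inj₂ b) r = (a , b) , inj₁ refl , r
  orientEdge (inj₂ b , inj₁ a) r = (a , b) , inj₂ refl , r
  orientEdge (inj₁ _ , inj₁ _) ()
  orientEdge (inj₂ _ , inj₂ _) ()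

  orient : ∀ es → IsEdgeSet (bipartite A B R) es →
    ∃ λ es′ → Pointwise Orients es es′ × Unique es′ × All (uncurry R) es′
  orient []       _                     = [] , [] , [] , []
  orient (e ∷ es) (r ∷ rs , d ∷ ds) with orientEdge e r | orient es (rs , ds)
  ... | ab , o , rab | es′ , os , u , rs′ = ab ∷ es′ , o ∷ os , Orients-≢ o d os ∷ u , rab ∷ rs′

  KFree-bipartite : ∀ {t} → ¬ HasSubgraph (bipartite A B R) (completeBipartite t t) → KFree t R
  KFree-bipartite {t} no-K = kFree λ f g f-inj g-inj k →
    no-K (Sum.map f g , (λ {u} {v} → inj f g f-inj g-inj u v) , λ {u} {v} → adj f g k u v)
    where
    inj : ∀ f g → Injective _≡_ _≡_ f → Injective _≡_ _≡_ g →
      ∀ (u v : Fin t ⊎ Fin t) → Sum.map f g u ≡ Sum.map f g v → u ≡ v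
    inj f g fi gi (inj₁ _) (inj₁ _) eq = cong inj₁ (fi (Sum.inj₁-injective eq))
    inj f g fi gi (inj₂ _) (inj₂ _) eq = cong inj₂ (gi (Sum.inj₂-injective eq))
    adj : ∀ (f : Fin t → A) (g : Fin t → B) → (∀ i j → R (f i) (g j)) → ∀ u v →
      Graph._~_ (completeBipartite t t) u v → Graph._~_ (bipartite A B R) (Sum.map f g u) (Sum.map f g v)
    adj f g k (inj₁ i) (inj₂ j) _ = k i j
    adj f g k (inj₂ j) (inj₁ i) _ = k i j

  AtMost-bipartite : ∀ {N} → Bounded R N → ∀ es → IsEdgeSet (bipartite A B R) es → length es ℕ.≤ N
  AtMost-bipartite bound es edges with orient es edges
  ... | es′ , os , u , rs = subst (ℕ._≤ _) (sym (Pointwise-length os)) (bound es′ u rs)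

-- Incidences of points and polytopes.

module Incidences {d s n : ℕ} (t : ℕ) (H : Fin s → Region d) (halfSpace : ∀ i → IsHalfSpace (H i))
  (Q : Fin n → Region d) (polytope : ∀ j → IsIntersectionOfTranslates H (Q j)) (X : Fin n → Point d)
  where

  open Linear {Fin n} {Fin n} t

  -- X p satisfies the constraints on Q q that come from translates of H i.
  Sideᴴ : Fin s → Fin n → Fin n → Set
  Sideᴴ i p q = All (λ (i′ , v) → i′ ≡ i → translate v (H i) (X p)) (proj₁ (polytope q))

  Sideᴴ⇒∈ : ∀ {p q} → (∀ i → Sideᴴ i p q) → Q q (X p)
  Sideᴴ⇒∈ {p} {q} sides = proj₂ (proj₂ (polytope q)) (All.tabulate λ {(i , v)} mem → All.lookup (sides i) mem refl)

  ∈⇒Sideᴴ : ∀ {p q} → Q q (X p) → ∀ i → Sideᴴ i p q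
  ∈⇒Sideᴴ {p} {q} ∈Q i = All.map (λ { ∈H refl → ∈H }) (proj₁ (proj₂ (polytope q)) ∈Q)

  val : ℕ → Fin s → Fin n → ℚ
  val m i p = dot (normal (halfSpace i) at m) (X p at m)

  -- All that the approximations at index `m` must preserve. Offsets and translation vectors are not
  -- approximated; new rational thresholds take their place.
  Separated : ℕ → Set
  Separated m = ∀ i p p′ q → Sideᴴ i p q → ¬ Sideᴴ i p′ q → val m i p ℚ.< val m i p′

  -- If the strict order failed, `X p′` would lie, up to double negation, in every translate of
  -- `H i` used for `Q q`, since `X p` does.
  Sideᴴ-separates : ∀ i p p′ q → Sideᴴ i p q → ¬ Sideᴴ i p′ q →
    ¬ ¬ Eventually (λ m → val m i p ℚ.< val m i p′)
  Sideᴴ-separates i p p′ q side ¬side ¬ev = ¬¬-All entry ¬side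
    where
    entry : ∀ {e} → e ∈ˡ proj₁ (polytope q) →
      ¬ ¬ (proj₁ e ≡ i → translate (proj₂ e) (H i) (X p′))
    entry {i′ , v} mem ¬h = compare (i′ Fin.≟ i)
      where
      compare : Dec (i′ ≡ i) → ⊥
      compare (no i′≢i)  = ¬h λ eq → contradiction eq i′≢i
      compare (yes refl) = translate-separates {S = H i} (halfSpace i) v (X p) (X p′) (All.lookup side mem refl)
        (λ ∈H → ¬h λ _ → ∈H) ¬ev

  ¬¬-Separated : (∀ i p q → Dec (Sideᴴ i p q)) → ¬ ¬ Eventually Separated
  ¬¬-Separated side? = ¬¬-Eventually-∀ λ i → ¬¬-Eventually-∀ λ p → ¬¬-Eventually-∀ λ p′ →
    ¬¬-Eventually-∀ λ q → decided i p p′ q (side? i p q) (side? i p′ q)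
    where
    decided : ∀ i p p′ q → Dec (Sideᴴ i p q) → Dec (Sideᴴ i p′ q) →
      ¬ ¬ Eventually (λ m → Sideᴴ i p q → ¬ Sideᴴ i p′ q → val m i p ℚ.< val m i p′)
    decided i p p′ q (yes side) (no ¬side) =
      ¬¬-map (λ (N , lt) → N , λ {_} N≤m _ _ → lt N≤m) (Sideᴴ-separates i p p′ q side ¬side)
    decided i p p′ q (no ¬side) _ ¬ev = ¬ev (0 , λ {_} _ side → contradiction side ¬side)
    decided i p p′ q _ (yes side) ¬ev = ¬ev (0 , λ {_} _ _ ¬side → contradiction side ¬side)

  -- On the points of `X`, all translates of `H i` used for `Q q` amount to one rational inequality,
  -- by `threshold`. Membership is then exactly a system of `s` constraints, however many translates
  -- occur, and elimination starts from the full relation with constant `t`.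
  Good-∈ : ∀ {m L} → (∀ i p q → Dec (Sideᴴ i p q)) → Separated m → n ℕ.< 2 ℕ.^ L → .{{_ : ℕ.NonZero L}} →
    Good (λ p q → Q q (X p)) (t ℕ.* (2 ℕ.^ s ℕ.* L) ℕ.^ (d ℕ.* 2 ℕ.⊓ s))
  Good-∈ {m} {L} side? separated n<2^L =
    Good-⇔ (λ (_ , sat) → Sideᴴ⇒∈ (sat⇒side sat)) (λ ∈Q → tt , side⇒sat (∈⇒Sideᴴ ∈Q))
      (Elimination.eliminate t L s n<2^L (λ p → X p at m) constraints s (All.universal (λ _ → tt) _)
        (ℕ.≤-reflexive (List.length-tabulate constraint)) ℕ.≤-refl (Good-⊤ (λ _ _ → tt)))
    where
    cut : ∀ i q → ∃ λ c → ∀ p → (Sideᴴ i p q → val m i p ℚ.≤ c) × (val m i p ℚ.≤ c → Sideᴴ i p q)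
    cut i q = threshold (val m i) (λ p → side? i p q) (λ p p′ → separated i p p′ q)
    constraint : Fin s → Constraint (Fin n) d
    constraint i = normal (halfSpace i) at m , λ q → proj₁ (cut i q)
    constraints : List (Constraint (Fin n) d)
    constraints = tabulate constraint
    sat⇒side : ∀ {p q} → Sat t (λ p → X p at m) constraints p q → ∀ i → Sideᴴ i p q
    sat⇒side {p} {q} sat i = proj₂ (proj₂ (cut i q) p) (All.tabulate⁻ sat i)
    side⇒sat : ∀ {p q} → (∀ i → Sideᴴ i p q) → Sat t (λ p → X p at m) constraints p q
    side⇒sat {p} {q} sides = All.tabulate⁺ λ i → proj₁ (proj₂ (cut i q) p) (sides i)

theorem1p7 : ∃[ c ] 0 ℕ.< c × (∀ (s : ℕ) → 0 ℕ.< s →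
    ∃[ C ] 0ℝ < C × (∀ (d t n : ℕ) → 0 ℕ.< d → 0 ℕ.< t → 3 ℕ.≤ n →
    (H : Fin s → Region d) → Injective _≡_ _≐_ H → (∀ i → IsHalfSpace (H i)) →
    (Q : Fin n → Region d) → Injective _≡_ _≐_ Q → (∀ j → IsIntersectionOfTranslates H (Q j)) →
    (X : Fin n → Point d) → Injective _≡_ _≈ᴾ_ X →
    ¬ HasSubgraph (incidenceGraph X Q) (completeBipartite t t) →
    AtMostEdges (incidenceGraph X Q) (C * fromℕ t * fromℕ n * ln n ^ (c ℕ.* d))))
-- The 2 stands for the two signs of each coordinate.
theorem1p7 = 2 , ℕ.z<s , λ s _ → fromℕ (constant s) , 0<C s ,
  -- As `_≤_` is a negation, a gap `ε` between the bound and the edge count is assumed from index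
  -- `N` on; the goal `⊥` permits classical reasoning.
  λ d t n _ _ 3≤n H _ halfSpace Q _ polytope X _ no-K es edges (ε , 0<ε , N , r+ε≤) →
    let open Incidences t H halfSpace Q polytope X
        r = fromℕ (constant s) * fromℕ t * fromℕ n * ln n ^ (2 ℕ.* d)
        l , n<2^ , log≤ = log₂-ln 3≤n
    in ¬¬-∀ (λ i → ¬¬-∀ λ p → ¬¬-∀ λ q → ¬¬-excluded-middle) λ side? →
       ¬¬-Separated side? λ (M , separated) →
       -- One index past the start of the gap, past the separation of the points, and past the index
       -- from which the terms of `ln n` are at least 1.
       let m = N ℕ.⊔ (M ℕ.⊔ 3)
           N≤m = ℕ.m≤m⊔n N (M ℕ.⊔ 3)
           M≤m = ℕ.≤-trans (ℕ.m≤m⊔n M 3) (ℕ.m≤n⊔m N (M ℕ.⊔ 3))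
           3≤m = ℕ.≤-trans (ℕ.m≤n⊔m M 3) (ℕ.m≤n⊔m N (M ℕ.⊔ 3))
           B = t ℕ.* (2 ℕ.^ s ℕ.* suc l) ℕ.^ (d ℕ.* 2 ℕ.⊓ s)
           edges≤ : length es ℕ.≤ B ℕ.* (n ℕ.+ n)
           edges≤ = AtMost-bipartite
             (Good⇒Bounded (Good-∈ side? (separated M≤m) n<2^) (KFree-bipartite no-K)) es edges
       in ℚ.<-irrefl refl (begin-strict
            seq r m ℚ.+ 0ℚ             <⟨ ℚ.+-monoʳ-< (seq r m) 0<ε ⟩
            seq r m ℚ.+ ε              ≤⟨ r+ε≤ N≤m ⟩
            toℚ (length es)            ≤⟨ toℚ-mono-≤ edges≤ ⟩
            toℚ (B ℕ.* (n ℕ.+ n))      ≤⟨ ℕ-bound-≤ {s} {t} {d} {n} {m} {suc l} (1≤ln 3≤n 3≤m) (log≤ 3≤m) ⟩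
            seq r m                    ≡⟨ ℚ.+-identityʳ (seq r m) ⟨
            seq r m ℚ.+ 0ℚ             ∎)
  where
  open ℚ.≤-Reasoning
  0<C : ∀ s → 0ℝ < fromℕ (constant s)
  0<C s = 1ℚ , ℚ.positive⁻¹ 1ℚ , 0 , λ _ → toℚ-mono-≤ {1} {constant s}
    (ℕ.*-mono-≤ (ℕ.*-mono-≤ (ℕ.s≤s {0} {1} ℕ.z≤n) (ℕ.m^n>0 (2 ℕ.^ s) {{ℕ.m^n≢0 2 s}} s)) (ℕ.m^n>0 3 s))
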